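{- For every positive integer $t$, as power series in $q$, the generating function $\widehat F_t(x;q)=\sum_{\lambda\lambda\in\mathcal{DD}}x^{\widehat n_t(\lambda\lambda)}q^{|\lambda\lambda|}$ equals \[ (-q^2;q^2)_\infty\left((1-x)q^{2t};q^{2t}\right)_\infty^{\frac{t-1}{2}}\left((1-x)q^{2t};q^{4t}\right)_\infty \] if $t$ is odd, and equals \[ (-q^2;q^2)_\infty\left((1-x)q^{2t};q^{2t}\right)_\infty^{\frac{t-2}{2}}\left((1-x)q^{2t};q^{4t}\right)_\infty\times\frac12\Big(\left(-\sqrt{1-x}\,q^t;-q^t\right)_\infty+\left(\sqrt{1-x}\,q^t;-q^t\right)_\infty\Big) \] if $t$ is even.
   Context: Notation: $(a;q)_\infty=\prod_{k\ge1}(1-aq^{k-1})$. (The even-$t$ expression does not depend on the choice of $\sqrt{1-x}$.) A partition is a finite weakly decreasing sequence of positive integers (the empty partition included); $|\lambda|$ is the sum of its parts. The box $(i,j)$ is the box in row $i$, column $j$ of the Young diagram. The hook of a box consists of the box itself and all boxes to its right in the same row or below it in the same column; the hook length is the number of boxes in the hook; a $t$-hook is a hook of length $t$. $\widehat n_t(\lambda)$ denotes the number of $t$-hooks of $\lambda$ above the main diagonal, i.e. the number of boxes $(i,j)$ with $j>i$ whose hook length is $t$. A strict partition is a partition into distinct parts. For a strict partition $\lambda=(\lambda_1>\dots>\lambda_\ell)$, the doubled distinct partition $\lambda\lambda$ is obtained from the shifted Young diagram of $\lambda$ (row $i$ moved right by $i-1$ boxes) by adding $\lambda_i$ boxes to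 the $(i-1)$-st column for each $i$; equivalently, $\lambda\lambda$ is the partition of $2|\lambda|$ with Frobenius symbol $\begin{pmatrix}\lambda_1&\cdots&\lambda_\ell\\ \lambda_1-1&\cdots&\lambda_\ell-1\end{pmatrix}$ (the Frobenius symbol of $\mu$ with Durfee square of side $s$ has top row $\mu_i-i$ and bottom row $\mu'_i-i$, $1\le i\le s$, where $\mu'$ is the conjugate partition). E.g. $\lambda=(5,4,1)$ gives $\lambda\lambda=(6,6,4,2,2)$. $\mathcal{DD}$ is the set of all doubled distinct partitions (including the empty one). -}

module Defs where

open import Algebra.Bundles using (CommutativeRing; RawSemiring)
open import Data.Bool.Base using (if_then_else_)
open import Data.Fin.Base using (Fin; toℕ)
open import Data.List.Base using (List; []; _∷_; _++_; map; filter; length; lookup; concatMap; upTo; allFin; foldr)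
open import Data.List.Membership.Propositional using (_∈_)
open import Data.List.Membership.Propositional.Properties using (∈-++⁺ˡ; ∈-++⁺ʳ; ∈-++⁻; ∈-map⁺; ∈-map⁻; ∈-filter⁺; ∈-filter⁻)
open import Data.List.Properties using (∷-injective; ∷-injectiveʳ)
open import Data.List.Relation.Unary.All as All using (All; []; _∷_)
open import Data.List.Relation.Unary.Any using (here)
open import Data.List.Relation.Unary.AllPairs using ([]; _∷_)
open import Data.List.Relation.Unary.Linked using (Linked; []; [-]; _∷_)
open import Data.List.Relation.Unary.Unique.Propositional using (Unique)
import Data.List.Relation.Unary.Unique.Propositional.Properties as Uniqueₚ
open import Data.Nat.ListAction using (sum)
open import Data.Nat.Base using (ℕ; zero; suc; _+_; _*_; _∸_; _≤_; _<_; _>_; _≥_; z≤n; s≤s)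
open import Data.Nat.Properties using (_≟_; _≤?_; _<?_; ≤-refl; ≤-trans; ≤-<-trans; ≤-pred; ≤∧≢⇒<; <⇒≤; 1+n≰n; m≤n⇒m≤1+n; m≤m+n; m≤n+m; m∸n≤m)
open import Data.Product.Base using (_×_; _,_; ∃-syntax; proj₁; proj₂)
open import Data.Sum.Base using (inj₁; inj₂)
open import Function.Base using (_∘_)
open import Function.Bundles using (_⇔_; mk⇔)
open import Relation.Binary.PropositionalEquality using (_≡_; _≢_; refl; sym; trans; cong; subst)
open import Relation.Nullary using (yes; no; does)
open import Relation.Nullary.Decidable using (_×-dec_; _⊎-dec_)
open import Data.Nat.Tactic.RingSolver using (solve-∀)

------------------------------------------------------------------------
-- Partitions and hooks

IsPartition : List ℕ → Set
IsPartition μ = Linked _≥_ μ × All (0 <_) μ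

IsStrict : List ℕ → Set
IsStrict λs = Linked _>_ λs × All (0 <_) λs

-- Rows and columns are counted from 0; hook lengths and the main
-- diagonal are unaffected by this shift of both coordinates.
Box : Set
Box = ℕ × ℕ

diagram : List ℕ → List Box
diagram μ = concatMap (λ i → map (toℕ i ,_) (upTo (lookup μ i))) (allFin (length μ))

hook : List ℕ → Box → List Box
hook μ (i , j) =
  filter (λ { (a , b) → (a ≟ i ×-dec j ≤? b) ⊎-dec (b ≟ j ×-dec i ≤? a) }) (diagram μ)

hookLength : List ℕ → Box → ℕ
hookLength μ b = length (hook μ b)

n̂ : ℕ → List ℕ → ℕ
n̂ t μ = length (filter (λ { (i , j) → i <? j ×-dec hookLength μ (i , j) ≟ t }) (diagram μ))

------------------------------------------------------------------------
-- Doubled distinct partitions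

-- Adds one box at the left end of each of the first h rows, creating new
-- rows where ν has fewer than h of them.
prependColumn : ℕ → List ℕ → List ℕ
prependColumn zero    ν       = ν
prependColumn (suc h) []      = 1 ∷ prependColumn h []
prependColumn (suc h) (r ∷ ν) = suc r ∷ prependColumn h ν

-- The first row of the shifted diagram has l boxes; below it, shifted one
-- step to the right, lies the shifted diagram of ls, whose own added
-- columns turn it into doubled ls.  The remaining added column, of length
-- l, goes to the left of all this.
doubled : List ℕ → List ℕ
doubled []       = []
doubled (l ∷ ls) = prependColumn l (l ∷ doubled ls)

IsDoubledDistinct : List ℕ → Set
IsDoubledDistinct μ = ∃[ λs ] IsStrict λs × μ ≡ doubled λs

_ : doubled (5 ∷ 4 ∷ 1 ∷ []) ≡ 6 ∷ 6 ∷ 4 ∷ 2 ∷ 2 ∷ []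
_ = refl

-- All strict partitions with parts at most m.
strictUpTo : ℕ → List (List ℕ)
strictUpTo zero    = [] ∷ []
strictUpTo (suc m) = strictUpTo m ++ map (suc m ∷_) (strictUpTo m)

-- See ∈-doubledDistinct and doubledDistinct-unique below: this lists each
-- doubled distinct partition of n exactly once.
doubledDistinct : ℕ → List (List ℕ)
doubledDistinct n = filter (λ μ → sum μ ≟ n) (map doubled (strictUpTo n))

prependColumn-sum : ∀ h ν → sum (prependColumn h ν) ≡ h + sum ν
prependColumn-sum zero    ν       = refl
prependColumn-sum (suc h) []      = cong suc (prependColumn-sum h [])
prependColumn-sum (suc h) (r ∷ ν) = cong suc (trans (cong (r +_) (prependColumn-sum h ν)) (lemma r h (sum ν)))
  where
  lemma : ∀ a b c → a + (b + c) ≡ b + (a + c)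
  lemma = solve-∀

doubled-sum : ∀ λs → sum (doubled λs) ≡ 2 * sum λs
doubled-sum []       = refl
doubled-sum (l ∷ ls) =
  trans (prependColumn-sum l (l ∷ doubled ls))
        (trans (cong (λ s → l + (l + s)) (doubled-sum ls)) (lemma l (sum ls)))
  where
  lemma : ∀ a b → a + (a + 2 * b) ≡ 2 * (a + b)
  lemma = solve-∀

prependColumn-positive : ∀ h {ν} → All (0 <_) ν → All (0 <_) (prependColumn h ν)
prependColumn-positive zero    ps       = ps
prependColumn-positive (suc h) []       = s≤s z≤n ∷ prependColumn-positive h []
prependColumn-positive (suc h) (_ ∷ ps) = s≤s z≤n ∷ prependColumn-positive h ps

prependColumn-decreasing : ∀ h {ν} → Linked _≥_ ν → Linked _≥_ (prependColumn h ν)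
prependColumn-decreasing zero          d       = d
prependColumn-decreasing (suc zero)    []      = [-]
prependColumn-decreasing (suc (suc h)) []      = ≤-refl ∷ prependColumn-decreasing (suc h) []
prependColumn-decreasing (suc zero)    [-]     = [-]
prependColumn-decreasing (suc (suc h)) [-]     = s≤s z≤n ∷ prependColumn-decreasing (suc h) []
prependColumn-decreasing (suc zero)    (p ∷ d) = m≤n⇒m≤1+n p ∷ d
prependColumn-decreasing (suc (suc h)) (p ∷ d) = s≤s p ∷ prependColumn-decreasing (suc h) d

doubled-positive : ∀ {λs} → All (0 <_) λs → All (0 <_) (doubled λs)
doubled-positive []                = []
doubled-positive {l ∷ _} (p ∷ ps) = prependColumn-positive l (p ∷ doubled-positive ps)

doubled-decreasing : ∀ {λs} → IsStrict λs → Linked _≥_ (doubled λs)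
doubled-decreasing {[]}               _                  = []
doubled-decreasing {l ∷ []}           _                  = prependColumn-decreasing l [-]
doubled-decreasing {l ∷ zero ∷ ls}    (_ , _ ∷ () ∷ _)
doubled-decreasing {l ∷ suc k ∷ ls}   (p ∷ d , _ ∷ ps)   =
  prependColumn-decreasing l (p ∷ doubled-decreasing (d , ps))

doubled-isPartition : ∀ {λs} → IsStrict λs → IsPartition (doubled λs)
doubled-isPartition s = doubled-decreasing s , doubled-positive (proj₂ s)

prependColumn-injective : ∀ h {ν ν′} → All (0 <_) ν → All (0 <_) ν′ →
                          prependColumn h ν ≡ prependColumn h ν′ → ν ≡ ν′
prependColumn-injective zero    _          _          eq = eq
prependColumn-injective (suc h) []         []         eq = refl
prependColumn-injective (suc h) []         (s≤s _ ∷ _) ()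
prependColumn-injective (suc h) (s≤s _ ∷ _) []         ()
prependColumn-injective (suc h) (_ ∷ ps)   (_ ∷ ps′)  eq with ∷-injective eq
... | refl , eq′ = cong (_ ∷_) (prependColumn-injective h ps ps′ eq′)

doubled-injective : ∀ {λs κs} → All (0 <_) λs → All (0 <_) κs →
                    doubled λs ≡ doubled κs → λs ≡ κs
doubled-injective []           []            _  = refl
doubled-injective []           (s≤s _ ∷ _)   ()
doubled-injective (s≤s _ ∷ _)  []            ()
doubled-injective {suc l ∷ _} {suc k ∷ _} (s≤s _ ∷ ps) (s≤s _ ∷ qs) eq with ∷-injective eq
... | refl , eq′ = cong (suc l ∷_) (doubled-injective ps qs
        (prependColumn-injective l (doubled-positive ps) (doubled-positive qs) eq′))

strictUpTo-≤ : ∀ m {λs} → λs ∈ strictUpTo m → All (_≤ m) λs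
strictUpTo-≤ zero    (here refl) = []
strictUpTo-≤ (suc m) λs∈ with ∈-++⁻ (strictUpTo m) λs∈
... | inj₁ ∈ˡ = All.map m≤n⇒m≤1+n (strictUpTo-≤ m ∈ˡ)
... | inj₂ ∈ʳ with ∈-map⁻ (suc m ∷_) ∈ʳ
...   | _ , κs∈ , refl = ≤-refl ∷ All.map m≤n⇒m≤1+n (strictUpTo-≤ m κs∈)

strictUpTo-sound : ∀ m {λs} → λs ∈ strictUpTo m → IsStrict λs
strictUpTo-sound zero    (here refl) = [] , []
strictUpTo-sound (suc m) λs∈ with ∈-++⁻ (strictUpTo m) λs∈
... | inj₁ ∈ˡ = strictUpTo-sound m ∈ˡ
... | inj₂ ∈ʳ with ∈-map⁻ (suc m ∷_) ∈ʳ
...   | κs , κs∈ , refl with strictUpTo-sound m κs∈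
...     | d , ps = cons (strictUpTo-≤ m κs∈) d , s≤s z≤n ∷ ps
  where
  cons : ∀ {κs} → All (_≤ m) κs → Linked _>_ κs → Linked _>_ (suc m ∷ κs)
  cons []      []  = [-]
  cons (b ∷ _) d   = s≤s b ∷ d

strictUpTo-complete : ∀ m {λs} → IsStrict λs → All (_≤ m) λs → λs ∈ strictUpTo m
strictUpTo-complete zero    {[]}     _ _ = here refl
strictUpTo-complete zero    {_ ∷ _} (_ , s≤s _ ∷ _) (() ∷ _)
strictUpTo-complete (suc m) {[]}     s _ = ∈-++⁺ˡ (strictUpTo-complete m s [])
strictUpTo-complete (suc m) {l ∷ ls} (d , p ∷ ps) (b ∷ bs) with l ≟ suc m
... | yes refl = ∈-++⁺ʳ (strictUpTo m) (∈-map⁺ (suc m ∷_) (strictUpTo-complete m (tail d , ps) (below d)))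
  where
  tail : ∀ {x xs} → Linked _>_ (x ∷ xs) → Linked _>_ xs
  tail [-]     = []
  tail (_ ∷ d) = d
  below : ∀ {k xs} → Linked _>_ (suc k ∷ xs) → All (_≤ k) xs
  below [-]           = []
  below (s≤s q ∷ d) = q ∷ below′ q d
    where
    below′ : ∀ {k x xs} → x ≤ k → Linked _>_ (x ∷ xs) → All (_≤ k) xs
    below′ q [-]     = []
    below′ q (r ∷ d) = ≤-trans (<⇒≤ r) q ∷ below′ (≤-trans (<⇒≤ r) q) d
... | no l≢ = ∈-++⁺ˡ (strictUpTo-complete m (d , p ∷ ps) (l≤m ∷ below l≤m d))
  where
  l≤m : l ≤ m
  l≤m = ≤-pred (≤∧≢⇒< b l≢)
  below : ∀ {k x xs} → x ≤ k → Linked _>_ (x ∷ xs) → All (_≤ k) xs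
  below q [-]     = []
  below q (r ∷ d) = ≤-trans (<⇒≤ r) q ∷ below (≤-trans (<⇒≤ r) q) d

strictUpTo-unique : ∀ m → Unique (strictUpTo m)
strictUpTo-unique zero    = [] ∷ []
strictUpTo-unique (suc m) =
  Uniqueₚ.++⁺ (strictUpTo-unique m) (Uniqueₚ.map⁺ ∷-injectiveʳ (strictUpTo-unique m)) disjoint
  where
  disjoint : ∀ {λs} → λs ∈ strictUpTo m × λs ∈ map (suc m ∷_) (strictUpTo m) → _
  disjoint (∈ˡ , ∈ʳ) with ∈-map⁻ (suc m ∷_) ∈ʳ
  ... | _ , _ , refl with strictUpTo-≤ m ∈ˡ
  ...   | b ∷ _ = 1+n≰n b

parts≤sum : ∀ λs → All (_≤ sum λs) λs
parts≤sum []       = []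
parts≤sum (l ∷ ls) = m≤m+n l (sum ls) ∷ All.map (λ b → ≤-trans b (m≤n+m (sum ls) l)) (parts≤sum ls)

∈-doubledDistinct : ∀ n μ → μ ∈ doubledDistinct n ⇔ (IsDoubledDistinct μ × sum μ ≡ n)
∈-doubledDistinct n μ = mk⇔ to from
  where
  to : μ ∈ doubledDistinct n → IsDoubledDistinct μ × sum μ ≡ n
  to μ∈ with ∈-filter⁻ (λ μ → sum μ ≟ n) {xs = map doubled (strictUpTo n)} μ∈
  ... | μ∈′ , size with ∈-map⁻ doubled μ∈′
  ...   | λs , λs∈ , eq = (λs , strictUpTo-sound n λs∈ , eq) , size

  from : IsDoubledDistinct μ × sum μ ≡ n → μ ∈ doubledDistinct n
  from ((λs , s , refl) , refl) =
    ∈-filter⁺ (λ μ → sum μ ≟ n)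
      (∈-map⁺ doubled (strictUpTo-complete n s (All.map (λ b → ≤-trans b bound) (parts≤sum λs)))) refl
    where
    bound : sum λs ≤ sum (doubled λs)
    bound = subst (sum λs ≤_) (sym (doubled-sum λs)) (m≤m+n (sum λs) _)

doubledDistinct-unique : ∀ n → Unique (doubledDistinct n)
doubledDistinct-unique n =
  Uniqueₚ.filter⁺ (λ μ → sum μ ≟ n)
    (unique (All.tabulate (λ λs∈ → proj₂ (strictUpTo-sound n λs∈))) (strictUpTo-unique n))
  where
  fresh : ∀ {λs xss} → All (0 <_) λs → All (All (0 <_)) xss →
          All (λs ≢_) xss → All (doubled λs ≢_) (map doubled xss)
  fresh p []       []       = []
  fresh p (q ∷ qs) (≢ ∷ ≢s) = (λ eq → ≢ (doubled-injective p q eq)) ∷ fresh p qs ≢s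

  unique : ∀ {xss} → All (All (0 <_)) xss → Unique xss → Unique (map doubled xss)
  unique []       []       = []
  unique (p ∷ ps) (≢s ∷ u) = fresh p ps ≢s ∷ unique ps u

------------------------------------------------------------------------
-- Formal power series in q over a commutative ring

module PowerSeries {c ℓ} (R : CommutativeRing c ℓ) where

  open CommutativeRing R
    using (Carrier; _≈_; 0#; 1#; -_; +-cong; +-congˡ; *-congˡ; *-cong; zeroˡ; zeroʳ; *-identityʳ; +-identityˡ; +-identityʳ; -‿inverseʳ; +-commutativeMonoid; semiring; -‿cong)
    renaming (_+_ to _+ᴿ_; _*_ to _*ᴿ_; _-_ to _-ᴿ_; refl to ≈-refl; sym to ≈-sym; trans to ≈-trans)
  open import Algebra.Properties.Semiring.Exp semiring using () renaming (_^_ to _^ᴿ_)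
  open import Algebra.Properties.CommutativeMonoid.Sum +-commutativeMonoid using (sum-cong-≋; sum-replicate-zero) renaming (sum to ∑)

  Series : Set c
  Series = ℕ → Carrier

  infix  4 _≈ˢ_
  infixl 6 _+ˢ_ _-ˢ_
  infixl 7 _*ˢ_
  infixr 7 _•_
  infix  9 _q^_

  _≈ˢ_ : Series → Series → Set ℓ
  f ≈ˢ g = ∀ n → f n ≈ g n

  -- The monomial a qᵐ.
  _q^_ : Carrier → ℕ → Series
  (a q^ m) n = if does (n ≟ m) then a else 0#

  0ˢ 1ˢ : Series
  0ˢ _ = 0#
  1ˢ   = 1# q^ 0

  _+ˢ_ _-ˢ_ _*ˢ_ : Series → Series → Series
  (f +ˢ g) n = f n +ᴿ g n
  (f -ˢ g) n = f n -ᴿ g n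
  (f *ˢ g) n = ∑ {suc n} (λ i → f (toℕ i) *ᴿ g (n ∸ toℕ i))

  _•_ : Carrier → Series → Series
  (a • f) n = a *ᴿ f n

  seriesRawSemiring : RawSemiring c ℓ
  seriesRawSemiring = record
    { Carrier = Series ; _≈_ = _≈ˢ_ ; _+_ = _+ˢ_ ; _*_ = _*ˢ_ ; 0# = 0ˢ ; 1# = 1ˢ }

  open import Algebra.Definitions.RawSemiring seriesRawSemiring public using () renaming (_^_ to _^ˢ_)

  -- (a ; b)_N
  pochhammer : Series → Series → ℕ → Series
  pochhammer a b zero    = 1ˢ
  pochhammer a b (suc N) = pochhammer a b N *ˢ (1ˢ -ˢ a *ˢ b ^ˢ N)

  -- (a ; b)_∞, for a and b with zero constant term.  The factors after the
  -- first n are then 1 + O(qⁿ⁺¹), so the coefficient of qⁿ is that of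
  -- (a ; b)_n; see pochhammer-stable.
  ⟨_⨾_⟩∞ : Series → Series → Series
  ⟨ a ⨾ b ⟩∞ n = pochhammer a b n n

  private
    ∑-zero : ∀ {n} (h : Fin n → Carrier) → (∀ i → h i ≈ 0#) → ∑ h ≈ 0#
    ∑-zero {n} h h≈0 = ≈-trans (sum-cong-≋ h≈0) (sum-replicate-zero n)

    *ˢ-congʳ≤ : ∀ f {g h} n → (∀ m → m ≤ n → g m ≈ h m) → (f *ˢ g) n ≈ (f *ˢ h) n
    *ˢ-congʳ≤ f n g≈h = sum-cong-≋ {suc n} (λ i → *-congˡ {f (toℕ i)} (g≈h (n ∸ toℕ i) (m∸n≤m n (toℕ i))))

    *ˢ-identityʳ : ∀ f n → (f *ˢ 1ˢ) n ≈ f n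
    *ˢ-identityʳ f zero    = ≈-trans (+-identityʳ _) (*-identityʳ _)
    *ˢ-identityʳ f (suc n) =
      ≈-trans (+-cong (zeroʳ _) (*ˢ-identityʳ (f ∘ suc) n)) (+-identityˡ _)

    order-* : ∀ f g k → f 0 ≈ 0# → (∀ m → m < k → g m ≈ 0#) → ∀ m → m < suc k → (f *ˢ g) m ≈ 0#
    order-* f g k f₀ g< zero m<k = ≈-trans (+-identityʳ _) (≈-trans (*-cong f₀ ≈-refl) (zeroˡ _))
    order-* f g k f₀ g< (suc m) (s≤s m<k) =
      ≈-trans (+-cong (≈-trans (*-cong f₀ ≈-refl) (zeroˡ _))
        (∑-zero {suc m} _ (λ i → ≈-trans (*-congˡ {f (suc (toℕ i))} (g< (m ∸ toℕ i) (≤-<-trans (m∸n≤m m (toℕ i)) m<k))) (zeroʳ _))))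
        (+-identityˡ _)

    order-^ : ∀ b → b 0 ≈ 0# → ∀ k m → m < k → (b ^ˢ k) m ≈ 0#
    order-^ b b₀ (suc k) = order-* b (b ^ˢ k) k b₀ (order-^ b b₀ k)

    -0≈0 : - 0# ≈ 0#
    -0≈0 = ≈-trans (≈-sym (+-identityˡ _)) (-‿inverseʳ _)

  pochhammer-suc : ∀ {a b} → a 0 ≈ 0# → b 0 ≈ 0# → ∀ n N → n ≤ N →
                   pochhammer a b (suc N) n ≈ pochhammer a b N n
  pochhammer-suc {a} {b} a₀ b₀ n N n≤N =
    ≈-trans (*ˢ-congʳ≤ (pochhammer a b N) n factor≈1) (*ˢ-identityʳ (pochhammer a b N) n)
    where
    factor≈1 : ∀ m → m ≤ n → (1ˢ -ˢ a *ˢ b ^ˢ N) m ≈ 1ˢ m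
    factor≈1 m m≤n = ≈-trans
      (+-congˡ (≈-trans (-‿cong (order-* a (b ^ˢ N) N a₀ (order-^ b b₀ N) m (s≤s (≤-trans m≤n n≤N)))) -0≈0))
      (+-identityʳ _)

  pochhammer-stable : ∀ {a b} → a 0 ≈ 0# → b 0 ≈ 0# → ∀ n k →
                      pochhammer a b (k + n) n ≈ ⟨ a ⨾ b ⟩∞ n
  pochhammer-stable         a₀ b₀ n zero    = ≈-refl
  pochhammer-stable {a} {b} a₀ b₀ n (suc k) =
    ≈-trans (pochhammer-suc {a} {b} a₀ b₀ n (k + n) (m≤n+m n k)) (pochhammer-stable {a} {b} a₀ b₀ n k)

  -- x is an arbitrary element of R; the case of an indeterminate is
  -- R = ℚ[√(1-x)], i.e. R = ℚ[y] with x = 1 - y².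
  F̂ : ℕ → Carrier → Series
  F̂ t x n = foldr _+ᴿ_ 0# (map (λ μ → x ^ᴿ n̂ t μ) (doubledDistinct n))

{-# OPTIONS --safe #-}
module Submission where

-- For a strict partition λ, the hooks of λλ above the diagonal in row i are
-- the bar lengths of λ: a part k ≥ t contributes a t-hook iff k − t is not a
-- part, and a part k < t iff t − k is a smaller part.  So the statistic only
-- couples parts that are congruent to ± each other modulo t, and F̂ is a
-- product over the multiples of t, the parts ≡ t/2, and the pairs of residues
-- ± r.  On each class the sum over all occupations is a linear chain.  With
-- v = x − 1, z = q²ᵗ and weights u, uz, uz², … the sum E(u; v) over the chain
-- satisfies
--   E(u; v) = (1 + u) E(uz; v) + vuz E(uz²; v),
--   E(u; v) = E(u; vz) + vzu E(uz; vz),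
-- the second because its right-hand side solves the first recurrence.  They
-- turn v ↦ vz or vz² into multiplication by a single factor:
--   E(z; v) + vz E(z²; v) = (1 + vz) (the same at vz²)          multiples of t,
--   P(v) = E(a; v) E(b; v) + vz E(az; v) E(bz; v), ab = z,
--   P(v) = (1 + vz) P(vz)                                       residues ± r,
--   Ψ(s) = E(w; −s²) + sw E(wz; −s²), w² = z,
--   Ψ(s) = (1 + sw) Ψ(−sw), 2 E(w; −s²) = Ψ(s) + Ψ(−s)          parts ≡ t/2,
-- and iterating down to v = 0 gives the products.  Since only coefficients up
-- to qⁿ matter, everything happens in the ring of series modulo qⁿ⁺¹, where q
-- is nilpotent and all products and chains are finite.

open import Algebra.Bundles using (CommutativeRing)
open import Data.Bool.Base using (Bool; true; false; if_then_else_; not; _∧_; _∨_)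
open import Data.Bool.Properties using (not-involutive; ∧-zeroʳ; ∧-identityʳ)
open import Data.Fin.Base using (Fin; toℕ)
open import Data.Fin.Properties using (toℕ≤pred[n])
open import Data.List.Base using (List; []; _∷_; _++_; map; filter; foldr; length; lookup; concatMap; concat; upTo; applyUpTo; tabulate)
open import Data.List.Membership.Propositional using (_∈_; _∉_)
open import Data.List.Membership.Propositional.Properties using (∈-++⁺ˡ; ∈-++⁺ʳ; ∈-++⁻; ∈-map⁻)
open import Data.List.Properties using (length-++; filter-++; filter-accept; filter-reject; map-tabulate; ++-assoc; ++-identityʳ)
open import Data.List.Relation.Binary.Permutation.Propositional using (_↭_; prep; swap; ↭-refl; ↭-trans; ↭-reflexive; ↭-sym; ↭⇒↭ₛ)
open import Data.List.Relation.Binary.Permutation.Propositional.Properties using (shift; shifts; ++⁺ˡ)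
import Data.List.Relation.Binary.Permutation.Setoid.Properties as Permutationₛ
open import Data.List.Relation.Unary.All as All using (All; []; _∷_)
open import Data.List.Relation.Unary.All.Properties using (++⁻ˡ)
open import Data.List.Relation.Unary.AllPairs using ([]; _∷_)
open import Data.List.Relation.Unary.Any using (here; there)
open import Data.List.Relation.Unary.Unique.Propositional using (Unique)
open import Data.Nat.Base using (ℕ; zero; suc; NonZero; >-nonZero⁻¹; _∸_; _≤_; _<_; _≤ᵇ_; _<ᵇ_; _≡ᵇ_; z≤n; s≤s) renaming (_+_ to _+ᴺ_; _*_ to _*ᴺ_)
open import Data.Nat.DivMod using (_/_; _%_; m≡m%n+[m/n]*n; m*n/n≡m; m%n<n)
open import Data.Nat.Divisibility using (_∣_; _∤_; divides; m%n≡0⇒n∣m)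
open import Data.Nat.ListAction using (sum)
open import Data.Nat.Properties using (_≟_; _≤?_; _<?_; ≤-refl; ≤-reflexive; ≤-trans; ≤-pred; ≤-<-trans; <-≤-trans; <⇒≤; <⇒≢; <⇒≱; ≤⇒≯; ≮⇒≥; ≰⇒>; m≤n⇒m<n∨m≡n; m≤n⇒∃[o]m+o≡n; m≤n⇒m≤1+n; n≤1+n; 1+n≰n; m≤m+n; m≤n+m; m<m+n; m≤m*n; m∸n≤m; m+n∸n≡m; m+n∸m≡n; m∸n+n≡m)
import Data.Nat.Properties as ℕ
open import Data.Nat.Tactic.RingSolver using (solve-∀)
open import Data.Product.Base using (_×_; _,_; ∃-syntax)
open import Data.Sum.Base using (_⊎_; inj₁; inj₂)
open import Defs
open import Function.Base using (_∘_; id)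
open import Level using (_⊔_)
open import Relation.Binary.PropositionalEquality as ≡ using (_≡_; _≢_)
open import Relation.Nullary using (Dec; yes; no; does; contradiction)
open import Relation.Nullary.Decidable using (dec-true; dec-false)
open import Relation.Unary using (Decidable)

-- Hook lengths as arm plus leg, and their count by rows.

module BarLengths where

  open import Data.Nat.Base using (_+_)
  open import Data.Nat.Properties using (+-identityʳ; +-suc; +-comm; +-assoc; +-cancelˡ-≡; +-cancelʳ-≡; +-∸-assoc; [m+n]∸[m+o]≡n∸o; m+[n∸m]≡n; m+n≤o⇒n≤o)
  open ≡ using (refl; sym; trans; cong; cong₂; module ≡-Reasoning)

  bit : Bool → ℕ
  bit b = if b then 1 else 0

  rowSum : (ℕ → ℕ) → ℕ → ℕ
  rowSum f zero    = 0
  rowSum f (suc r) = f 0 + rowSum (f ∘ suc) r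

  diagramSum : (ℕ → ℕ → ℕ) → List ℕ → ℕ
  diagramSum f []      = 0
  diagramSum f (r ∷ μ) = rowSum (f 0) r + diagramSum (f ∘ suc) μ

  rowSum-cong : ∀ {f g} r → (∀ j → j < r → f j ≡ g j) → rowSum f r ≡ rowSum g r
  rowSum-cong zero    f≡g = refl
  rowSum-cong (suc r) f≡g = cong₂ _+_ (f≡g 0 (s≤s z≤n)) (rowSum-cong r (λ j j<r → f≡g (suc j) (s≤s j<r)))

  diagramSum-cong : ∀ {f g} μ → (∀ i j → f i j ≡ g i j) → diagramSum f μ ≡ diagramSum g μ
  diagramSum-cong []      f≡g = refl
  diagramSum-cong (r ∷ μ) f≡g = cong₂ _+_ (rowSum-cong r (λ j _ → f≡g 0 j)) (diagramSum-cong μ (f≡g ∘ suc))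

  rowSum-zero : ∀ r → rowSum (λ _ → 0) r ≡ 0
  rowSum-zero zero    = refl
  rowSum-zero (suc r) = rowSum-zero r

  rowSum-+ : ∀ f m k → rowSum f (m + k) ≡ rowSum f m + rowSum (f ∘ (m +_)) k
  rowSum-+ f zero    k = refl
  rowSum-+ f (suc m) k = trans (cong (f 0 +_) (rowSum-+ (f ∘ suc) m k)) (sym (+-assoc (f 0) _ _))

  module _ {P : Box → Set} (P? : Decidable P) where

    count-row : ∀ i r f → length (filter P? (map (i ,_) (applyUpTo f r))) ≡ rowSum (λ j → bit (does (P? (i , f j)))) r
    count-row i zero    f = refl
    count-row i (suc r) f with does (P? (i , f 0))
    ... | true  = cong suc (count-row i r (f ∘ suc))
    ... | false = count-row i r (f ∘ suc)

    -- `d` renumbers the rows, since the induction passes to the tail of `μ` while the row indices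
    -- keep counting.
    count-rows : ∀ μ (d : ℕ → ℕ) →
      length (filter P? (concat (tabulate (λ (i : Fin (length μ)) → map (d (toℕ i) ,_) (upTo (lookup μ i))))))
      ≡ diagramSum (λ i j → bit (does (P? (d i , j)))) μ
    count-rows []      d = refl
    count-rows (r ∷ μ) d = begin
      length (filter P? (row ++ rest))                   ≡⟨ cong length (filter-++ P? row rest) ⟩
      length (filter P? row ++ filter P? rest)           ≡⟨ length-++ (filter P? row) ⟩
      length (filter P? row) + length (filter P? rest)   ≡⟨ cong₂ _+_ (count-row (d 0) r id) (count-rows μ (d ∘ suc)) ⟩
      _ ∎
      where
      open ≡-Reasoning
      row = map (d 0 ,_) (upTo r)
      rest = concat (tabulate (λ (i : Fin (length μ)) → map (d (suc (toℕ i)) ,_) (upTo (lookup μ i))))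

    count-diagram : ∀ μ → length (filter P? (diagram μ)) ≡ diagramSum (λ i j → bit (does (P? (i , j)))) μ
    count-diagram μ = trans (cong (λ rows → length (filter P? (concat rows))) (map-tabulate id (λ i → map (toℕ i ,_) (upTo (lookup μ i))))) (count-rows μ id)

  -- For a partition, the part of index `j`, from 0, of its conjugate.
  column : List ℕ → ℕ → ℕ
  column []      j = 0
  column (r ∷ μ) j = bit (j <ᵇ r) + column μ j

  -- `r ∸ j` counts the box together with its arm, `column` of the lower rows counts the leg.
  armLegSum : List ℕ → ℕ → ℕ → ℕ
  armLegSum []      i       j = 0
  armLegSum (r ∷ μ) zero    j = (r ∸ j) + column μ j
  armLegSum (r ∷ μ) (suc i) j = armLegSum μ i j

  rowSum-≡ : ∀ r j → rowSum (λ b → bit (b ≡ᵇ j)) r ≡ bit (j <ᵇ r)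
  rowSum-≡ zero    j       = refl
  rowSum-≡ (suc r) zero    = cong suc (rowSum-zero r)
  rowSum-≡ (suc r) (suc j) = rowSum-≡ r j

  diagramSum-column : ∀ μ j → diagramSum (λ a b → bit (b ≡ᵇ j)) μ ≡ column μ j
  diagramSum-column []      j = refl
  diagramSum-column (r ∷ μ) j = cong₂ _+_ (rowSum-≡ r j) (diagramSum-column μ j)

  suc-≤ᵇ : ∀ j b → (suc j ≤ᵇ suc b) ≡ (j ≤ᵇ b)
  suc-≤ᵇ zero    b = refl
  suc-≤ᵇ (suc j) b = refl

  -- In the row of the box itself the column condition only repeats the box, which the row condition
  -- has already.
  rowSum-arm : ∀ r j → rowSum (λ b → bit ((j ≤ᵇ b) ∨ ((b ≡ᵇ j) ∧ true))) r ≡ r ∸ j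
  rowSum-arm zero    zero    = refl
  rowSum-arm zero    (suc j) = refl
  rowSum-arm (suc r) zero    = cong suc (rowSum-arm r zero)
  rowSum-arm (suc r) (suc j) = trans (rowSum-cong r (λ b _ → cong (λ c → bit (c ∨ ((b ≡ᵇ j) ∧ true))) (suc-≤ᵇ j b))) (rowSum-arm r j)

  hookLength-armLegSum : ∀ μ i j → hookLength μ (i , j) ≡ armLegSum μ i j
  hookLength-armLegSum μ i j = trans (count-diagram _ μ) (go μ i)
    where
    go : ∀ μ i → diagramSum (λ a b → bit (((a ≡ᵇ i) ∧ (j ≤ᵇ b)) ∨ ((b ≡ᵇ j) ∧ (i ≤ᵇ a)))) μ ≡ armLegSum μ i j
    go []      i       = refl
    go (r ∷ μ) zero    = cong₂ _+_ (rowSum-arm r j)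
      (trans (diagramSum-cong μ (λ a b → cong bit (∧-identityʳ (b ≡ᵇ j)))) (diagramSum-column μ j))
    go (r ∷ μ) (suc i) = cong₂ _+_
      (trans (rowSum-cong r (λ b _ → cong bit (∧-zeroʳ (b ≡ᵇ j)))) (rowSum-zero r))
      (trans (diagramSum-cong μ (λ a b → cong (λ c → bit (((a ≡ᵇ i) ∧ (j ≤ᵇ b)) ∨ ((b ≡ᵇ j) ∧ c))) (suc-≤ᵇ i a))) (go μ i))

  -- `d` is the column of the diagonal box in the first listed row, hence `suc d` for the rest.
  hooksAbove : ℕ → ℕ → List ℕ → ℕ
  hooksAbove t d []      = 0
  hooksAbove t d (r ∷ μ) = rowSum (λ j → bit ((d <ᵇ j) ∧ ((r ∸ j) + column μ j ≡ᵇ t))) r + hooksAbove t (suc d) μ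

  n̂-hooksAbove : ∀ t μ → n̂ t μ ≡ hooksAbove t 0 μ
  n̂-hooksAbove t μ = trans (count-diagram _ μ)
    (trans (diagramSum-cong μ (λ i j → cong (λ h → bit ((i <ᵇ j) ∧ (h ≡ᵇ t))) (hookLength-armLegSum μ i j))) (go μ 0))
    where
    go : ∀ μ d → diagramSum (λ i j → bit ((d + i <ᵇ j) ∧ (armLegSum μ i j ≡ᵇ t))) μ ≡ hooksAbove t d μ
    go []      d = refl
    go (r ∷ μ) d = cong₂ _+_
      (rowSum-cong r (λ j _ → cong (λ e → bit ((e <ᵇ j) ∧ ((r ∸ j) + column μ j ≡ᵇ t))) (+-identityʳ d)))
      (trans (diagramSum-cong μ (λ i j → cong (λ e → bit ((e <ᵇ j) ∧ (armLegSum μ i j ≡ᵇ t))) (+-suc d i))) (go μ (suc d)))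

  -- Prepended columns and the first row of a doubled partition.

  column-prependColumn-zero : ∀ h ν → length ν ≤ h → column (prependColumn h ν) 0 ≡ h
  column-prependColumn-zero zero    []      _       = refl
  column-prependColumn-zero (suc h) []      _       = cong suc (column-prependColumn-zero h [] z≤n)
  column-prependColumn-zero (suc h) (r ∷ ν) (s≤s p) = cong suc (column-prependColumn-zero h ν p)

  column-prependColumn-suc : ∀ h ν → length ν ≤ h → ∀ j → column (prependColumn h ν) (suc j) ≡ column ν j
  column-prependColumn-suc zero    []      _       j = refl
  column-prependColumn-suc (suc h) []      _       j = column-prependColumn-suc h [] z≤n j
  column-prependColumn-suc (suc h) (r ∷ ν) (s≤s p) j = cong (bit (j <ᵇ r) +_) (column-prependColumn-suc h ν p j)

  length-prependColumn : ∀ h ν → length ν ≤ h → length (prependColumn h ν) ≡ h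
  length-prependColumn zero    []      _       = refl
  length-prependColumn (suc h) []      _       = cong suc (length-prependColumn h [] z≤n)
  length-prependColumn (suc h) (r ∷ ν) (s≤s p) = cong suc (length-prependColumn h ν p)

  -- The new column shifts boxes and diagonal alike. By `length ν ≤ h` every row of `ν` is shifted,
  -- so legs are preserved; the new column itself lies left of the diagonal at `suc d`.
  hooksAbove-prependColumn : ∀ t d h ν → length ν ≤ h → hooksAbove t (suc d) (prependColumn h ν) ≡ hooksAbove t d ν
  hooksAbove-prependColumn t d zero    []      _       = refl
  hooksAbove-prependColumn t d (suc h) []      _       = trans (hooksAbove-prependColumn t (suc d) h [] z≤n) refl
  hooksAbove-prependColumn t d (suc h) (r ∷ ν) (s≤s p) = cong₂ _+_
    (rowSum-cong r (λ j _ → cong (λ c → bit ((d <ᵇ j) ∧ ((r ∸ j) + c ≡ᵇ t))) (column-prependColumn-suc h ν p j)))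
    (hooksAbove-prependColumn t (suc d) h ν p)

  -- Strict partitions with parts at most `n`. Writing a part as `suc m` gives positivity and hands
  -- the bound `m` to the tail.
  data StrictBelow : ℕ → List ℕ → Set where
    []  : ∀ {n} → StrictBelow n []
    _∷_ : ∀ {m n ms} → suc m ≤ n → StrictBelow m ms → StrictBelow n (suc m ∷ ms)

  weaken : ∀ {n n′ ms} → n ≤ n′ → StrictBelow n ms → StrictBelow n′ ms
  weaken n≤n′ []      = []
  weaken n≤n′ (p ∷ s) = ≤-trans p n≤n′ ∷ s

  strictUpTo-below : ∀ n {λs} → λs ∈ strictUpTo n → StrictBelow n λs
  strictUpTo-below zero    (here refl) = []
  strictUpTo-below (suc n) λs∈ with ∈-++⁻ (strictUpTo n) λs∈
  ... | inj₁ ∈ˡ = weaken (n≤1+n n) (strictUpTo-below n ∈ˡ)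
  ... | inj₂ ∈ʳ with ∈-map⁻ (suc n ∷_) ∈ʳ
  ...   | _ , κs∈ , refl = ≤-refl ∷ strictUpTo-below n κs∈

  length-doubled : ∀ {n ms} → StrictBelow n ms → length (doubled ms) ≤ n
  length-doubled                []                 = z≤n
  length-doubled {n} {suc m ∷ ms} (p ∷ s) =
    ≤-trans (≤-reflexive (cong suc (length-prependColumn m (doubled ms) (length-doubled s)))) p

  column-doubled-zero : ∀ {m ms} → StrictBelow m ms → column (doubled (suc m ∷ ms)) 0 ≡ suc m
  column-doubled-zero {m} {ms} s = cong suc (column-prependColumn-zero m (doubled ms) (length-doubled s))

  column-doubled-suc : ∀ {m ms} → StrictBelow m ms → ∀ j →
                       column (doubled (suc m ∷ ms)) (suc j) ≡ bit (j <ᵇ suc m) + column (doubled ms) j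
  column-doubled-suc {m} {ms} s j = cong (bit (j <ᵇ suc m) +_) (column-prependColumn-suc m (doubled ms) (length-doubled s) j)

  <ᵇ-true : ∀ {m n} → m < n → (m <ᵇ n) ≡ true
  <ᵇ-true {m} {n} = dec-true (m <? n)

  <ᵇ-false : ∀ {m n} → n ≤ m → (m <ᵇ n) ≡ false
  <ᵇ-false {m} {n} n≤m = dec-false (m <? n) (≤⇒≯ n≤m)

  ≡ᵇ-true : ∀ {m n} → m ≡ n → (m ≡ᵇ n) ≡ true
  ≡ᵇ-true {m} {n} = dec-true (m ≟ n)

  ≡ᵇ-false : ∀ {m n} → m ≢ n → (m ≡ᵇ n) ≡ false
  ≡ᵇ-false {m} {n} = dec-false (m ≟ n)

  column-doubled-beyond : ∀ {n ms} → StrictBelow n ms → ∀ j → n < j → column (doubled ms) j ≡ 0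
  column-doubled-beyond []                j       _         = refl
  column-doubled-beyond (_∷_ {m} p s) (suc j) (s≤s n≤j) = trans (column-doubled-suc s j)
    (cong₂ _+_ (cong bit (<ᵇ-false (≤-trans p n≤j))) (column-doubled-beyond s j (≤-trans p n≤j)))

  -- For `ν = doubled ls` with smaller parts `ls`, these are the hook lengths right of the diagonal
  -- in the first row of `doubled (l ∷ ls)`, that is, the bar lengths of the part l: the numbers 1,
  -- ..., l and l + m, without l - m, for the smaller parts m.
  firstRowHooks : ℕ → ℕ → List ℕ → ℕ
  firstRowHooks t l ν = rowSum (λ j → bit ((l ∸ j) + column ν j ≡ᵇ t)) l

  -- The prepended column contains the diagonal box of the first row; the lower rows are
  -- `doubled ls`, shifted by that column together with their diagonal.
  n̂-doubled : ∀ t {l ls} → StrictBelow l ls →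
              n̂ t (doubled (suc l ∷ ls)) ≡ firstRowHooks t (suc l) (doubled ls) + n̂ t (doubled ls)
  n̂-doubled t {l} {ls} s = trans (n̂-hooksAbove t (doubled (suc l ∷ ls))) (cong₂ _+_
    (rowSum-cong (suc l) (λ j _ → cong (λ c → bit ((suc l ∸ j) + c ≡ᵇ t)) (column-prependColumn-suc l (doubled ls) (length-doubled s) j)))
    (trans (hooksAbove-prependColumn t 0 l (doubled ls) (length-doubled s)) (sym (n̂-hooksAbove t (doubled ls)))))

  -- Adding the part suc m to ms adds the bar length l + (suc m) and removes
  -- l - (suc m) = suc k; the latter is moved to the left-hand side.
  firstRowHooks-∷ : ∀ t k {l m ms} → suc m + suc k ≡ l → StrictBelow m ms →
    firstRowHooks t l (doubled (suc m ∷ ms)) + bit (suc k ≡ᵇ t)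
    ≡ bit (l + suc m ≡ᵇ t) + firstRowHooks t l (doubled ms)
  firstRowHooks-∷ t k {_} {m} {ms} refl s = begin
    bit (l + column D 0 ≡ᵇ t) + rowSum (λ j → bit ((m + suc k ∸ j) + column D (suc j) ≡ᵇ t)) (m + suc k) + bit (suc k ≡ᵇ t)
      ≡⟨ cong (_+ bit (suc k ≡ᵇ t)) (cong₂ _+_ (cong (λ c → bit (l + c ≡ᵇ t)) (column-doubled-zero s)) (trans (cong (rowSum F) (+-suc m k)) (rowSum-+ F (suc m) k))) ⟩
    bit (l + suc m ≡ᵇ t) + (rowSum (λ j → bit ((m + suc k ∸ j) + column D (suc j) ≡ᵇ t)) (suc m) + rowSum (λ i → bit ((m + suc k ∸ (suc m + i)) + column D (suc (suc m + i)) ≡ᵇ t)) k) + bit (suc k ≡ᵇ t)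
      ≡⟨ cong (λ e → bit (l + suc m ≡ᵇ t) + e + bit (suc k ≡ᵇ t)) (cong₂ _+_ (rowSum-cong (suc m) head) (rowSum-cong k tail)) ⟩
    bit (l + suc m ≡ᵇ t) + (R + T) + bit (suc k ≡ᵇ t)
      ≡⟨ +-assoc (bit (l + suc m ≡ᵇ t)) _ _ ⟩
    bit (l + suc m ≡ᵇ t) + (R + T + bit (suc k ≡ᵇ t))
      ≡⟨ cong (bit (l + suc m ≡ᵇ t) +_) (trans (+-assoc R T _) (cong (R +_) (trans (+-comm T _) (sym (rowSum-cong (suc k) rest))))) ⟩
    bit (l + suc m ≡ᵇ t) + (R + rowSum (λ i → bit ((l ∸ (suc m + i)) + column (doubled ms) (suc m + i) ≡ᵇ t)) (suc k))
      ≡⟨ cong (bit (l + suc m ≡ᵇ t) +_) (sym (rowSum-+ (λ j → bit ((l ∸ j) + column (doubled ms) j ≡ᵇ t)) (suc m) (suc k))) ⟩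
    bit (l + suc m ≡ᵇ t) + firstRowHooks t l (doubled ms) ∎
    where
    open ≡-Reasoning
    l = suc m + suc k
    D = doubled (suc m ∷ ms)
    F : ℕ → ℕ
    F j = bit ((m + suc k ∸ j) + column D (suc j) ≡ᵇ t)
    R = rowSum (λ j → bit ((l ∸ j) + column (doubled ms) j ≡ᵇ t)) (suc m)
    T = rowSum (λ i → bit (k ∸ i ≡ᵇ t)) k
    -- Box `suc j` of the new row has the hook length of box `j` of the old one: its arm is shorter
    -- by one, its leg longer by one.
    head : ∀ j → j < suc m → bit ((m + suc k ∸ j) + column D (suc j) ≡ᵇ t) ≡ bit ((l ∸ j) + column (doubled ms) j ≡ᵇ t)
    head j j<1+m = cong (λ h → bit (h ≡ᵇ t)) (begin
      (m + suc k ∸ j) + column D (suc j)                            ≡⟨ cong ((m + suc k ∸ j) +_) (column-doubled-suc s j) ⟩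
      (m + suc k ∸ j) + (bit (j <ᵇ suc m) + column (doubled ms) j)  ≡⟨ cong (λ b → (m + suc k ∸ j) + (bit b + column (doubled ms) j)) (<ᵇ-true j<1+m) ⟩
      (m + suc k ∸ j) + suc (column (doubled ms) j)                 ≡⟨ +-suc (m + suc k ∸ j) _ ⟩
      suc (m + suc k ∸ j) + column (doubled ms) j                   ≡⟨ cong (_+ column (doubled ms) j) (sym (+-∸-assoc 1 (≤-trans (≤-pred j<1+m) (m≤m+n m (suc k))))) ⟩
      (l ∸ j) + column (doubled ms) j                               ∎)
    beyond : ∀ i → column (doubled ms) (suc m + i) ≡ 0
    beyond i = column-doubled-beyond s (suc m + i) (m≤m+n (suc m) i)
    -- From here on all legs vanish: the new row ends with the lengths k, ..., 1, the old one with
    -- `suc k`, ..., 1.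
    tail : ∀ i → i < k → bit ((m + suc k ∸ (suc m + i)) + column D (suc (suc m + i)) ≡ᵇ t) ≡ bit (k ∸ i ≡ᵇ t)
    tail i _ = cong (λ h → bit (h ≡ᵇ t)) (begin
      (m + suc k ∸ (suc m + i)) + column D (suc (suc m + i))
        ≡⟨ cong₂ _+_ (cong (_∸ (suc m + i)) (+-suc m k)) (column-doubled-suc s (suc m + i)) ⟩
      (suc m + k ∸ (suc m + i)) + (bit (suc m + i <ᵇ suc m) + column (doubled ms) (suc m + i))
        ≡⟨ cong₂ _+_ ([m+n]∸[m+o]≡n∸o (suc m) k i) (cong₂ _+_ (cong bit (<ᵇ-false (m≤m+n (suc m) i))) (beyond i)) ⟩
      (k ∸ i) + 0
        ≡⟨ +-identityʳ _ ⟩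
      k ∸ i ∎)
    rest : ∀ i → i < suc k → bit ((l ∸ (suc m + i)) + column (doubled ms) (suc m + i) ≡ᵇ t) ≡ bit (suc k ∸ i ≡ᵇ t)
    rest i _ = cong (λ h → bit (h ≡ᵇ t)) (trans (cong₂ _+_ ([m+n]∸[m+o]≡n∸o (suc m) (suc k) i) (beyond i)) (+-identityʳ _))

  -- Bars of length `t` read off from the occupied positions.

  Occupation : Set
  Occupation = ℕ → Bool

  set : ℕ → Occupation → Occupation
  set p σ k = if k ≡ᵇ p then true else σ k

  ∅ : Occupation
  ∅ _ = false

  occupied : List ℕ → Occupation
  occupied []       = ∅
  occupied (m ∷ ms) = set m (occupied ms)

  set-same : ∀ p σ → set p σ p ≡ true
  set-same p σ = cong (λ b → if b then true else σ p) (≡ᵇ-true {p} refl)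

  set-other : ∀ {p k} σ → k ≢ p → set p σ k ≡ σ k
  set-other {p} {k} σ k≢p = cong (λ b → if b then true else σ k) (≡ᵇ-false k≢p)

  occupied-beyond : ∀ {n ms} → StrictBelow n ms → ∀ k → n < k → occupied ms k ≡ false
  occupied-beyond []      k n<k = refl
  occupied-beyond {ms = suc m ∷ ms} (p ∷ s) k n<k =
    trans (set-other (occupied ms) (λ { refl → <⇒≱ n<k p })) (occupied-beyond s k (≤-trans (s≤s (≤-trans (n≤1+n m) p)) n<k))

  rowSum-∸ : ∀ {t} l → 0 < t → rowSum (λ j → bit (l ∸ j ≡ᵇ t)) l ≡ bit (t ≤ᵇ l)
  rowSum-∸ {suc t} zero    _ = refl
  rowSum-∸ {suc t} (suc l) _ with l ≟ t
  ... | yes refl = trans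
    (cong₂ _+_ (cong bit (≡ᵇ-true {l} refl)) (trans (rowSum-∸ {suc l} l (s≤s z≤n)) (cong bit (<ᵇ-false {l} ≤-refl))))
    (sym (cong bit (<ᵇ-true {l} {suc l} ≤-refl)))
  ... | no l≢t = trans (cong₂ _+_ (cong bit (≡ᵇ-false l≢t)) (rowSum-∸ {suc t} l (s≤s z≤n))) (cong bit (<-suc l t l≢t))
    where
    <-suc : ∀ l t → l ≢ t → (t <ᵇ l) ≡ (t <ᵇ suc l)
    <-suc zero    zero    l≢t = contradiction refl l≢t
    <-suc zero    (suc t) l≢t = refl
    <-suc (suc l) zero    l≢t = refl
    <-suc (suc l) (suc t) l≢t = <-suc l t (λ l≡t → l≢t (cong suc l≡t))

  -- As `t ≤ suc l`, no length `suc l` + m equals `t`. Among 1, ..., `suc l` the length `t` is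
  -- removed precisely when `suc l ∸ t` is a part. The additive form avoids truncated subtraction.
  firstRowHooks-long : ∀ {t l ls} → 0 < t → t ≤ suc l → StrictBelow l ls →
    firstRowHooks t (suc l) (doubled ls) + bit (occupied ls (suc l ∸ t)) ≡ 1
  firstRowHooks-long {t} {l} 0<t t≤l [] = trans (+-identityʳ _) (trans
    (rowSum-cong (suc l) (λ j _ → cong (λ h → bit (h ≡ᵇ t)) (+-identityʳ (suc l ∸ j))))
    (trans (rowSum-∸ (suc l) 0<t) (cong bit (dec-true (t ≤? suc l) t≤l))))
  firstRowHooks-long {t} {l} {suc m ∷ ms} 0<t t≤l (p ∷ s) with m≤n⇒∃[o]m+o≡n p
  ... | k , 1+m+k≡l = combine (suc k ≟ t)
    where
    open ≡-Reasoning
    H  = firstRowHooks t (suc l) (doubled ms)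
    H′ = firstRowHooks t (suc l) (doubled (suc m ∷ ms))
    l≡ : suc m + suc k ≡ suc l
    l≡ = trans (+-suc (suc m) k) (cong suc 1+m+k≡l)
    IH : H + bit (occupied ms (suc l ∸ t)) ≡ 1
    IH = firstRowHooks-long 0<t t≤l (weaken (≤-trans (n≤1+n m) p) s)
    H′≡H : H′ + bit (suc k ≡ᵇ t) ≡ H
    H′≡H = trans (firstRowHooks-∷ t k l≡ s)
      (cong (λ b → bit b + H) (≡ᵇ-false (λ e → <⇒≢ (≤-<-trans t≤l (m<m+n (suc l) (s≤s z≤n))) (sym e))))
    combine : Dec (suc k ≡ t) → H′ + bit (occupied (suc m ∷ ms) (suc l ∸ t)) ≡ 1
    -- Here `suc m` is the part `suc l ∸ t` itself, and the parts in `ms` are smaller.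
    combine (yes refl) = begin
      H′ + bit (occupied (suc m ∷ ms) (suc l ∸ t))  ≡⟨ cong (λ p → H′ + bit (occupied (suc m ∷ ms) p)) l∸t ⟩
      H′ + bit (occupied (suc m ∷ ms) (suc m))      ≡⟨ cong (λ b → H′ + bit b) (trans (set-same (suc m) (occupied ms)) (sym (≡ᵇ-true {k} refl))) ⟩
      H′ + bit (suc k ≡ᵇ suc k)                     ≡⟨ H′≡H ⟩
      H                                             ≡⟨ +-identityʳ H ⟨
      H + 0                                         ≡⟨ cong (λ b → H + bit b) (trans (cong (occupied ms) l∸t) (occupied-beyond s (suc m) ≤-refl)) ⟨
      H + bit (occupied ms (suc l ∸ t))             ≡⟨ IH ⟩
      1                                             ∎
      where
      l∸t : suc l ∸ suc k ≡ suc m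
      l∸t = trans (cong (_∸ suc k) (sym l≡)) (m+n∸n≡m (suc m) (suc k))
    combine (no 1+k≢t) = begin
      H′ + bit (occupied (suc m ∷ ms) (suc l ∸ t))  ≡⟨ cong (λ b → H′ + bit b) (set-other (occupied ms) l∸t≢) ⟩
      H′ + bit (occupied ms (suc l ∸ t))            ≡⟨ cong (_+ bit (occupied ms (suc l ∸ t))) (trans (sym (+-identityʳ H′)) (trans (cong (λ b → H′ + bit b) (sym (≡ᵇ-false 1+k≢t))) H′≡H)) ⟩
      H + bit (occupied ms (suc l ∸ t))             ≡⟨ IH ⟩
      1                                             ∎
      where
      l∸t≢ : suc l ∸ t ≢ suc m
      l∸t≢ e = 1+k≢t (+-cancelˡ-≡ (suc m) _ _ (trans l≡ (trans (sym (m∸n+n≡m t≤l)) (cong (_+ t) e))))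

  -- Beyond `suc l` only the lengths `suc l` + m remain, and such a length is `t` when m is
  -- `t ∸ suc l`.
  firstRowHooks-short : ∀ {t l ls} → suc l < t → StrictBelow l ls →
    firstRowHooks t (suc l) (doubled ls) ≡ bit (occupied ls (t ∸ suc l))
  firstRowHooks-short {t} {l} l<t [] = trans
    (rowSum-cong (suc l) (λ j _ → cong (λ h → bit (h ≡ᵇ t)) (+-identityʳ (suc l ∸ j))))
    (trans (rowSum-∸ (suc l) (≤-trans (s≤s z≤n) l<t)) (cong bit (dec-false (t ≤? suc l) (<⇒≱ l<t))))
  firstRowHooks-short {t} {l} {suc m ∷ ms} l<t (p ∷ s) with m≤n⇒∃[o]m+o≡n p
  ... | k , 1+m+k≡l = combine (suc l + suc m ≟ t)
    where
    open ≡-Reasoning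
    H  = firstRowHooks t (suc l) (doubled ms)
    H′ = firstRowHooks t (suc l) (doubled (suc m ∷ ms))
    IH : H ≡ bit (occupied ms (t ∸ suc l))
    IH = firstRowHooks-short l<t (weaken (≤-trans (n≤1+n m) p) s)
    H′≡ : H′ ≡ bit (suc l + suc m ≡ᵇ t) + H
    H′≡ = begin
      H′                                  ≡⟨ +-identityʳ H′ ⟨
      H′ + 0                              ≡⟨ cong (λ b → H′ + bit b) (≡ᵇ-false (<⇒≢ (≤-<-trans (s≤s (m+n≤o⇒n≤o (suc m) (≤-reflexive 1+m+k≡l))) l<t))) ⟨
      H′ + bit (suc k ≡ᵇ t)               ≡⟨ firstRowHooks-∷ t k (trans (+-suc (suc m) k) (cong suc 1+m+k≡l)) s ⟩
      bit (suc l + suc m ≡ᵇ t) + H        ∎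
    combine : Dec (suc l + suc m ≡ t) → H′ ≡ bit (occupied (suc m ∷ ms) (t ∸ suc l))
    combine (yes refl) = begin
      H′                                  ≡⟨ H′≡ ⟩
      bit (suc l + suc m ≡ᵇ t) + H        ≡⟨ cong₂ (λ b h → bit b + h) (≡ᵇ-true {suc l + suc m} refl) (trans IH (cong bit (trans (cong (occupied ms) t∸l) (occupied-beyond s (suc m) ≤-refl)))) ⟩
      1                                   ≡⟨ cong bit (trans (cong (occupied (suc m ∷ ms)) t∸l) (set-same (suc m) (occupied ms))) ⟨
      bit (occupied (suc m ∷ ms) (t ∸ suc l)) ∎
      where
      t∸l : suc l + suc m ∸ suc l ≡ suc m
      t∸l = m+n∸m≡n (suc l) (suc m)
    combine (no l+m≢t) = begin
      H′                                  ≡⟨ H′≡ ⟩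
      bit (suc l + suc m ≡ᵇ t) + H        ≡⟨ cong (λ b → bit b + H) (≡ᵇ-false l+m≢t) ⟩
      H                                   ≡⟨ IH ⟩
      bit (occupied ms (t ∸ suc l))       ≡⟨ cong bit (set-other (occupied ms) (λ e → l+m≢t (trans (cong (suc l +_) (sym e)) (m+[n∸m]≡n (<⇒≤ l<t))))) ⟨
      bit (occupied (suc m ∷ ms) (t ∸ suc l)) ∎

  -- Whether the part k has a bar of length t.  The second conjunct counts the
  -- bar of length k + (t - k) only once, in the row of the larger part.
  bar : ℕ → ℕ → Occupation → Bool
  bar t k σ = if t ≤ᵇ k then not (σ (k ∸ t)) else σ (t ∸ k) ∧ (t ∸ k <ᵇ k)

  firstRowHooks-bar : ∀ {t l ls} → 0 < t → StrictBelow l ls →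
    firstRowHooks t (suc l) (doubled ls) ≡ bit (bar t (suc l) (occupied ls))
  firstRowHooks-bar {t} {l} {ls} 0<t s with t ≤? suc l
  ... | yes t≤l = trans (complement σˡ (firstRowHooks-long 0<t t≤l s))
      (cong (λ b → bit (if b then not σˡ else occupied ls (t ∸ suc l) ∧ (t ∸ suc l <ᵇ suc l))) (sym (dec-true (t ≤? suc l) t≤l)))
    where
    σˡ = occupied ls (suc l ∸ t)
    complement : ∀ {h} b → h + bit b ≡ 1 → h ≡ bit (not b)
    complement {h} true  e = +-cancelʳ-≡ 1 h 0 e
    complement {h} false e = trans (sym (+-identityʳ h)) e
  ... | no t≰l = trans (firstRowHooks-short (≰⇒> t≰l) s) (trans (cong bit (small (t ∸ suc l)))
      (cong (λ b → bit (if b then not (occupied ls (suc l ∸ t)) else occupied ls (t ∸ suc l) ∧ (t ∸ suc l <ᵇ suc l))) (sym (dec-false (t ≤? suc l) t≰l))))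
    where
    -- An occupied `k` is a part of `ls`, hence at most `l`; this supplies the second conjunct of
    -- `bar`.
    small : ∀ k → occupied ls k ≡ occupied ls k ∧ (k <ᵇ suc l)
    small k with k <? suc l
    ... | yes k<l = sym (trans (cong (occupied ls k ∧_) (<ᵇ-true k<l)) (∧-identityʳ _))
    ... | no k≮l = trans free (cong (_∧ _) (sym free))
      where free = occupied-beyond s k (≮⇒≥ k≮l)

  -- Both branches of `bar` look only below `k`, the second through its conjunct. So parts larger
  -- than `k` do not affect the bar of `k`.
  bar-cong : ∀ {t k σ τ} → 0 < t → 0 < k → (∀ j → j < k → σ j ≡ τ j) → bar t k σ ≡ bar t k τ
  bar-cong {t} {k} {σ} {τ} 0<t 0<k σ≡τ = cong₂ (if t ≤ᵇ k then_else_)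
    (cong not (σ≡τ (k ∸ t) (k∸t<k t k 0<t 0<k))) (below (t ∸ k))
    where
    k∸t<k : ∀ t k → 0 < t → 0 < k → k ∸ t < k
    k∸t<k (suc t) (suc k) _ _ = s≤s (m∸n≤m k t)
    below : ∀ j → σ j ∧ (j <ᵇ k) ≡ τ j ∧ (j <ᵇ k)
    below j with j <? k
    ... | yes j<k = cong (_∧ (j <ᵇ k)) (σ≡τ j j<k)
    ... | no j≮k = trans (cong (σ j ∧_) (<ᵇ-false (≮⇒≥ j≮k)))
      (trans (∧-zeroʳ (σ j)) (sym (trans (cong (τ j ∧_) (<ᵇ-false (≮⇒≥ j≮k))) (∧-zeroʳ (τ j)))))

-- Arithmetic progressions modulo `t` and mirrored residues.

module Progressions where

  open import Data.Nat.Base using (_+_; _*_)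
  open import Data.Nat.Properties using (+-identityʳ; +-suc; +-comm)
  open ≡ using (refl; sym; trans; cong; subst; setoid)

  concatMap-↭ : ∀ {a b} {A : Set a} {B : Set b} (f : A → List B) {xs ys} → xs ↭ ys → concatMap f xs ↭ concatMap f ys
  concatMap-↭ f _↭_.refl        = ↭-refl
  concatMap-↭ f (prep x p)      = ++⁺ˡ (f x) (concatMap-↭ f p)
  concatMap-↭ f (swap x y p)    = ↭-trans (shifts (f x) (f y)) (++⁺ˡ (f y) (++⁺ˡ (f x) (concatMap-↭ f p)))
  concatMap-↭ f (_↭_.trans p q) = ↭-trans (concatMap-↭ f p) (concatMap-↭ f q)

  Unique-resp-↭ : ∀ {xs ys : List ℕ} → xs ↭ ys → Unique xs → Unique ys
  Unique-resp-↭ p = Permutationₛ.Unique-resp-↭ (setoid ℕ) (↭⇒↭ₛ p)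

  Disjoint : List ℕ → List ℕ → Set
  Disjoint xs ys = ∀ k → k ∈ xs → k ∉ ys

  Unique-++⁻ʳ : ∀ xs {ys : List ℕ} → Unique (xs ++ ys) → Unique ys
  Unique-++⁻ʳ []       u       = u
  Unique-++⁻ʳ (x ∷ xs) (_ ∷ u) = Unique-++⁻ʳ xs u

  Unique-++⁻ˡ : ∀ xs {ys : List ℕ} → Unique (xs ++ ys) → Unique xs
  Unique-++⁻ˡ []       u        = []
  Unique-++⁻ˡ (x ∷ xs) (x∉ ∷ u) = ++⁻ˡ xs x∉ ∷ Unique-++⁻ˡ xs u

  Unique⇒Disjoint : ∀ xs {ys : List ℕ} → Unique (xs ++ ys) → Disjoint xs ys
  Unique⇒Disjoint (x ∷ xs) (x∉ ∷ u) .x (here refl) k∈ys = All.lookup x∉ (∈-++⁺ʳ xs k∈ys) refl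
  Unique⇒Disjoint (x ∷ xs) (x∉ ∷ u) k (there k∈xs) k∈ys = Unique⇒Disjoint xs u k k∈xs k∈ys

  down : ℕ → List ℕ
  down zero    = []
  down (suc n) = suc n ∷ down n

  down-≤ : ∀ n {k} → k ∈ down n → k ≤ n
  down-≤ (suc n) (here refl) = ≤-refl
  down-≤ (suc n) (there k∈)  = m≤n⇒m≤1+n (down-≤ n k∈)

  down-Unique : ∀ n → Unique (down n)
  down-Unique zero    = []
  down-Unique (suc n) = All.tabulate (λ k∈ e → 1+n≰n (≤-trans (≤-reflexive e) (down-≤ n k∈))) ∷ down-Unique n

  0∉down : ∀ n → 0 ∉ down n
  0∉down (suc n) (there 0∈) = 0∉down n 0∈

  segment : ℕ → ℕ → List ℕ
  segment a zero    = []
  segment a (suc n) = suc a ∷ segment (suc a) n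

  segment-+ : ∀ a m n → segment a (m + n) ≡ segment a m ++ segment (a + m) n
  segment-+ a zero    n = cong (λ b → segment b n) (sym (+-identityʳ a))
  segment-+ a (suc m) n = cong (suc a ∷_) (trans (segment-+ (suc a) m n) (cong (λ b → segment (suc a) m ++ segment b n) (sym (+-suc a m))))

  segment-last : ∀ a n → segment a (suc n) ↭ suc (a + n) ∷ segment a n
  segment-last a n = ↭-trans
    (↭-reflexive (trans (cong (segment a) (+-comm 1 n)) (segment-+ a n 1)))
    (↭-trans (shift (suc (a + n)) (segment a n) []) (prep _ (↭-reflexive (++-identityʳ _))))

  down↭segment : ∀ n → down n ↭ segment 0 n
  down↭segment zero    = ↭-refl
  down↭segment (suc n) = ↭-trans (prep (suc n) (down↭segment n)) (↭-sym (segment-last 0 n))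

  progression : ℕ → ℕ → ℕ → List ℕ
  progression t zero    r = []
  progression t (suc N) r = r ∷ progression t N (r + t)

  progression-≥ : ∀ t N {r k} → k ∈ progression t N r → r ≤ k
  progression-≥ t (suc N) (here refl) = ≤-refl
  progression-≥ t (suc N) (there k∈)  = ≤-trans (m≤m+n _ t) (progression-≥ t N k∈)

  -- The first block of `t` numbers supplies the heads of the progressions, the remaining blocks by
  -- induction their tails.
  segment↭progressions : ∀ t N a → segment a (N * t) ↭ concatMap (progression t N) (segment a t)
  segment↭progressions t zero    a = ↭-reflexive (sym (empty (segment a t)))
    where
    empty : ∀ xs → concatMap (progression t 0) xs ≡ []
    empty []       = refl
    empty (x ∷ xs) = empty xs
  segment↭progressions t (suc N) a = ↭-trans (↭-reflexive (segment-+ a t (N * t)))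
    (↭-trans (++⁺ˡ (segment a t) (segment↭progressions t N (a + t))) (↭-sym (heads a t)))
    where
    heads : ∀ a n → concatMap (progression t (suc N)) (segment a n) ↭ segment a n ++ concatMap (progression t N) (segment (a + t) n)
    heads a zero    = ↭-refl
    heads a (suc n) = prep (suc a) (↭-trans (++⁺ˡ (progression t N (suc a + t)) (heads (suc a) n)) (shifts (progression t N (suc a + t)) (segment (suc a) n)))

  Pairs : Set
  Pairs = List (ℕ × ℕ)

  flatten : Pairs → List ℕ
  flatten []             = []
  flatten ((r , s) ∷ ps) = r ∷ s ∷ flatten ps

  -- The numbers a + 1, …, a + 2 k + e without the e middle ones, each paired with its mirror image.
  mirrored : ℕ → ℕ → ℕ → Pairs
  mirrored e a zero    = []
  mirrored e a (suc k) = (suc a , suc (suc (a + (k * 2 + e)))) ∷ mirrored e (suc a) k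

  length-mirrored : ∀ e a k → length (mirrored e a k) ≡ k
  length-mirrored e a zero    = refl
  length-mirrored e a (suc k) = cong suc (length-mirrored e (suc a) k)

  segment↭mirrored : ∀ e a k → segment a (k * 2 + e) ↭ segment (a + k) e ++ flatten (mirrored e a k)
  segment↭mirrored e a zero    = ↭-trans (↭-reflexive (cong (λ b → segment b e) (sym (+-identityʳ a)))) (↭-reflexive (sym (++-identityʳ _)))
  segment↭mirrored e a (suc k) = ↭-trans (prep (suc a) (segment-last (suc a) (k * 2 + e)))
    (↭-trans (++⁺ˡ (suc a ∷ suc (suc (a + (k * 2 + e))) ∷ []) (segment↭mirrored e (suc a) k))
    (↭-trans (shifts (suc a ∷ suc (suc (a + (k * 2 + e))) ∷ []) (segment (suc a + k) e))
      (↭-reflexive (cong (λ b → segment b e ++ flatten (mirrored e a (suc k))) (sym (+-suc a k))))))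

  IsMirrored : ℕ → ℕ × ℕ → Set
  IsMirrored t (r , s) = 0 < r × r < s × r + s ≡ t

  -- Moving inwards raises `a` and lowers `k` by one each, which preserves the sum. At a = 0 it is
  -- the modulus `t`.
  mirrored-sum : ∀ e a k → All (IsMirrored (suc (a + a + (k * 2 + e)))) (mirrored e a k)
  mirrored-sum e a zero    = []
  mirrored-sum e a (suc k) =
    (s≤s z≤n , s≤s (s≤s (m≤m+n a n)) , total)
    ∷ subst (λ t → All (IsMirrored t) (mirrored e (suc a) k)) total′ (mirrored-sum e (suc a) k)
    where
    n = k * 2 + e
    total : suc a + suc (suc (a + n)) ≡ suc (a + a + suc (suc n))
    total = total-lemma a n
      where
      total-lemma : ∀ a n → suc a + suc (suc (a + n)) ≡ suc (a + a + suc (suc n))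
      total-lemma = solve-∀
    total′ : suc (suc a + suc a + n) ≡ suc (a + a + suc (suc n))
    total′ = total′-lemma a n
      where
      total′-lemma : ∀ a n → suc (suc a + suc a + n) ≡ suc (a + a + suc (suc n))
      total′-lemma = solve-∀

open BarLengths
open Progressions

-- Chain sums: recurrences and product evaluations.

module Chains {c ℓ} (S : CommutativeRing c ℓ) where

  open CommutativeRing S
  open import Algebra.Properties.Ring ring using (-‿distribˡ-*; -‿distribʳ-*; -‿involutive; -0#≈0#; -‿+-comm)
  open import Algebra.Properties.Semiring.Exp semiring using (_^_; ^-congˡ)
  open import Algebra.Properties.CommutativeSemiring.Exp commutativeSemiring using (^-distrib-*)
  open import Algebra.Solver.Ring.NaturalCoefficients.Default commutativeSemiring using (solve; _:=_; _:+_; _:*_; con)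
  open import Relation.Binary.Reasoning.Setoid setoid

  poch : Carrier → Carrier → ℕ → Carrier
  poch a b zero    = 1#
  poch a b (suc N) = poch a b N * (1# - a * b ^ N)

  poch-cong : ∀ {a a′ b b′} N → a ≈ a′ → b ≈ b′ → poch a b N ≈ poch a′ b′ N
  poch-cong zero    p q = refl
  poch-cong (suc N) p q = *-cong (poch-cong N p q) (+-congˡ (-‿cong (*-cong p (^-congˡ N q))))

  -- The factors 1 + v dⁱ c with i < N multiply to (-vc; d)_N. For nilpotent `d` the leftover value
  -- is that of `φ` at zero.
  poch-iterate : (φ : Carrier → Carrier) → (∀ {v v′} → v ≈ v′ → φ v ≈ φ v′) → ∀ c d →
                 (∀ v → φ v ≈ (1# + v * c) * φ (v * d)) →
                 ∀ v N → φ v ≈ poch (- (v * c)) d N * φ (v * d ^ N)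
  poch-iterate φ φ-cong c d step v zero    = trans (φ-cong (sym (*-identityʳ v))) (sym (*-identityˡ _))
  poch-iterate φ φ-cong c d step v (suc N) = begin
    φ v                                                                   ≈⟨ poch-iterate φ φ-cong c d step v N ⟩
    poch a d N * φ (v * d ^ N)                                            ≈⟨ *-congˡ (step _) ⟩
    poch a d N * ((1# + v * d ^ N * c) * φ (v * d ^ N * d))               ≈⟨ *-assoc _ _ _ ⟨
    poch a d N * (1# + v * d ^ N * c) * φ (v * d ^ N * d)                 ≈⟨ *-cong (*-congˡ (+-congˡ factor)) (φ-cong (trans (*-assoc _ _ _) (*-congˡ (*-comm _ _)))) ⟩
    poch a d (suc N) * φ (v * d ^ suc N)                                  ∎
    where
    a = - (v * c)
    factor : v * d ^ N * c ≈ - (a * d ^ N)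
    factor = begin
      v * d ^ N * c      ≈⟨ solve 3 (λ v D c → v :* D :* c := v :* c :* D) refl v (d ^ N) c ⟩
      v * c * d ^ N      ≈⟨ -‿involutive _ ⟨
      - - (v * c * d ^ N) ≈⟨ -‿cong (-‿distribˡ-* _ _) ⟩
      - (a * d ^ N)      ∎

  -- The Boolean is the state of the predecessor; the factor 1 + v, standing for x, marks a
  -- `t`-hook.
  weight : Bool → Carrier → Carrier → Carrier
  weight occupied v u = u * (if occupied then 1# else 1# + v)

  -- The sum over all occupations of N consecutive positions, where the k-th
  -- one contributes u zᵏ when occupied, times 1 + v when moreover its
  -- predecessor is empty; the Boolean is the state of the predecessor of the
  -- first position.  Using v = x - 1 instead of x keeps the identities free of
  -- subtraction, as the semiring solver requires.
  chain : Carrier → Bool → Carrier → ℕ → Carrier → Carrier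
  chain z b v zero    u = 1#
  chain z b v (suc N) u = chain z false v N (u * z) + weight b v u * chain z true v N (u * z)

  -- The product (-u; z)_N.
  chain₀ : Carrier → ℕ → Carrier → Carrier
  chain₀ z zero    u = 1#
  chain₀ z (suc N) u = (1# + u) * chain₀ z N (u * z)

  weight-cong : ∀ b {v v′ u u′} → v ≈ v′ → u ≈ u′ → weight b v u ≈ weight b v′ u′
  weight-cong true  p q = *-cong q refl
  weight-cong false p q = *-cong q (+-congˡ p)

  chain-cong : ∀ {z z′} b {v v′} N {u u′} → z ≈ z′ → v ≈ v′ → u ≈ u′ → chain z b v N u ≈ chain z′ b v′ N u′
  chain-cong b zero    r p q = refl
  chain-cong b (suc N) r p q =
    +-cong (chain-cong false N r p (*-cong q r)) (*-cong (weight-cong b p q) (chain-cong true N r p (*-cong q r)))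

  -- At v = 0 the positions decouple.
  chain-zero : ∀ z b v N u → v ≈ 0# → chain z b v N u ≈ chain₀ z N u
  chain-zero z b v zero    u v≈0 = refl
  chain-zero z b v (suc N) u v≈0 = begin
    chain z false v N (u * z) + weight b v u * chain z true v N (u * z)
      ≈⟨ +-cong (chain-zero z false v N _ v≈0) (*-cong (weight-zero b) (chain-zero z true v N _ v≈0)) ⟩
    chain₀ z N (u * z) + u * chain₀ z N (u * z)
      ≈⟨ solve 2 (λ u C → C :+ u :* C := (con 1 :+ u) :* C) refl u _ ⟩
    (1# + u) * chain₀ z N (u * z) ∎
    where
    weight-zero : ∀ b → weight b v u ≈ u
    weight-zero true  = *-identityʳ u
    weight-zero false = trans (*-congˡ (trans (+-congˡ v≈0) (+-identityʳ 1#))) (*-identityʳ u)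

  chain-false : ∀ z v N u → chain z false v (suc N) u ≈ chain z true v (suc N) u + v * u * chain z true v N (u * z)
  chain-false z v N u = solve 4 (λ v u A C → A :+ u :* (con 1 :+ v) :* C := (A :+ u :* con 1 :* C) :+ v :* u :* C) refl v u _ _

  -- The additional last position has a weight divisible by u zᴺ.
  chain-stable : ∀ z b v N u → u * z ^ N ≈ 0# → chain z b v (suc N) u ≈ chain z b v N u
  chain-stable z b v zero    u u≈0 = begin
    1# + weight b v u * 1#   ≈⟨ +-congˡ (*-assoc _ _ _) ⟩
    1# + u * _               ≈⟨ +-congˡ (*-congʳ (trans (sym (*-identityʳ u)) u≈0)) ⟩
    1# + 0# * _              ≈⟨ +-congˡ (zeroˡ _) ⟩
    1# + 0#                  ≈⟨ +-identityʳ _ ⟩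
    1#                       ∎
  chain-stable z b v (suc N) u u≈0 =
    +-cong (chain-stable z false v N (u * z) uz≈0) (*-congˡ (chain-stable z true v N (u * z) uz≈0))
    where
    uz≈0 : u * z * z ^ N ≈ 0#
    uz≈0 = trans (*-assoc _ _ _) u≈0

  chain-vanish : ∀ z b v N {u} → u ≈ 0# → chain z b v N u ≈ 1#
  chain-vanish z b v zero    u≈0 = refl
  chain-vanish z b v (suc N) u≈0 =
    trans (chain-stable z b v N _ (trans (*-congʳ u≈0) (zeroˡ _))) (chain-vanish z b v N u≈0)

  module Nilpotent (z : Carrier) (N : ℕ) (zᴺ≈0 : z ^ N ≈ 0#) where

    -- The infinite chain after an occupied predecessor: by `suc-N` one more position no longer
    -- changes the sum.
    E : Carrier → Carrier → Carrier
    E v u = chain z true v N u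

    E-cong : ∀ {v v′ u u′} → v ≈ v′ → u ≈ u′ → E v u ≈ E v′ u′
    E-cong = chain-cong true N refl

    uzᴺ≈0 : ∀ u → u * z ^ N ≈ 0#
    uzᴺ≈0 u = trans (*-congˡ zᴺ≈0) (zeroʳ u)

    suc-N : ∀ b v u → chain z b v N u ≈ chain z b v (suc N) u
    suc-N b v u = sym (chain-stable z b v N u (uzᴺ≈0 u))

    chain-false-E : ∀ v u → chain z false v N u ≈ E v u + v * u * E v (u * z)
    chain-false-E v u = trans (suc-N false v u) (trans (chain-false z v N u) (+-congʳ (sym (suc-N true v u))))

    -- An empty first position leaves a chain after an empty predecessor, which `chain-false-E`
    -- turns back into values of `E`.
    E-rec : ∀ v u → E v u ≈ (1# + u) * E v (u * z) + v * u * z * E v (u * z * z)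
    E-rec v u = begin
      E v u
        ≈⟨ suc-N true v u ⟩
      chain z false v N (u * z) + u * 1# * E v (u * z)
        ≈⟨ +-congʳ (chain-false-E v (u * z)) ⟩
      E v (u * z) + v * (u * z) * E v (u * z * z) + u * 1# * E v (u * z)
        ≈⟨ solve 5 (λ u v z B C → (B :+ v :* (u :* z) :* C) :+ u :* con 1 :* B := (con 1 :+ u) :* B :+ v :* u :* z :* C) refl u v z _ _ ⟩
      (1# + u) * E v (u * z) + v * u * z * E v (u * z * z) ∎

    private
      -- Multiplying by `z` on the right makes the arguments match those of `E-rec` definitionally.
      shifted : Carrier → ℕ → Carrier
      shifted u zero    = u
      shifted u (suc k) = shifted u k * z

      shifted≈ : ∀ u k → shifted u k ≈ u * z ^ k
      shifted≈ u zero    = sym (*-identityʳ u)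
      shifted≈ u (suc k) = trans (*-congʳ (shifted≈ u k)) (trans (*-assoc _ _ _) (*-congˡ (*-comm _ _)))

    -- The recurrence expresses the value at u by those at uz and uz². Since u zᴺ vanishes, both
    -- functions are 1 there, and descending to u carries the equality along.
    E-unique : ∀ v (G : Carrier → Carrier) →
               (∀ u → G u ≈ (1# + u) * G (u * z) + v * u * z * G (u * z * z)) →
               (∀ {u} → u ≈ 0# → G u ≈ 1#) → ∀ u → E v u ≈ G u
    E-unique v G G-rec G-zero u = descend N (at-zero shifted≈0) (at-zero (trans (*-congʳ shifted≈0) (zeroˡ z)))
      where
      shifted≈0 : shifted u N ≈ 0#
      shifted≈0 = trans (shifted≈ u N) (uzᴺ≈0 u)
      at-zero : ∀ {u} → u ≈ 0# → E v u ≈ G u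
      at-zero u≈0 = trans (chain-vanish z true v N u≈0) (sym (G-zero u≈0))
      descend : ∀ k → E v (shifted u k) ≈ G (shifted u k) → E v (shifted u (suc k)) ≈ G (shifted u (suc k)) → E v u ≈ G u
      descend zero    p q = p
      descend (suc k) p q = descend k
        (trans (E-rec v (shifted u k)) (trans (+-cong (*-congˡ p) (*-congˡ q)) (sym (G-rec (shifted u k))))) p

    E-shift : ∀ v u → E v u ≈ E (v * z) u + v * z * u * E (v * z) (u * z)
    E-shift v = E-unique v G G-rec G-zero
      where
      G : Carrier → Carrier
      G u = E (v * z) u + v * z * u * E (v * z) (u * z)
      G-rec : ∀ u → G u ≈ (1# + u) * G (u * z) + v * u * z * G (u * z * z)
      -- Expanding both values on the left leaves only `E (v * z)` at uz, uz² and uz³, and the claim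
      -- becomes a polynomial identity.
      G-rec u = trans (+-cong (E-rec (v * z) u) (*-congˡ (E-rec (v * z) (u * z))))
          (solve 6 (λ v z u e₁ e₂ e₃ →
              (con 1 :+ u) :* e₁ :+ v :* z :* u :* z :* e₂ :+ v :* z :* u :* ((con 1 :+ u :* z) :* e₂ :+ v :* z :* (u :* z) :* z :* e₃)
            := (con 1 :+ u) :* (e₁ :+ v :* z :* (u :* z) :* e₂) :+ v :* u :* z :* (e₂ :+ v :* z :* (u :* z :* z) :* e₃))
            refl v z u _ _ _)
      G-zero : ∀ {u} → u ≈ 0# → G u ≈ 1#
      G-zero u≈0 = trans (+-cong (chain-vanish z true _ N u≈0) (trans (*-congʳ (trans (*-congˡ u≈0) (zeroʳ _))) (zeroˡ _))) (+-identityʳ 1#)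

    -- The recurrence at `v * z`, with two of its terms collected by `E-shift` at `u * z`.
    E-shift′ : ∀ v u → E (v * z) u ≈ E v (u * z) + u * E (v * z) (u * z)
    E-shift′ v u = begin
      E (v * z) u
        ≈⟨ E-rec (v * z) u ⟩
      (1# + u) * E (v * z) (u * z) + v * z * u * z * E (v * z) (u * z * z)
        ≈⟨ solve 5 (λ v z u e₁ e₂ → (con 1 :+ u) :* e₁ :+ v :* z :* u :* z :* e₂ := e₁ :+ v :* z :* (u :* z) :* e₂ :+ u :* e₁) refl v z u _ _ ⟩
      E (v * z) (u * z) + v * z * (u * z) * E (v * z) (u * z * z) + u * E (v * z) (u * z)
        ≈⟨ +-congʳ (E-shift v (u * z)) ⟨
      E v (u * z) + u * E (v * z) (u * z) ∎

    -- After `E-shift`, the terms with factor v z are those that `E-shift′` collects into a second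
    -- copy of `E (v * z) u`.
    E-unshift : ∀ v u → E v u + v * z * E v (u * z) ≈ (1# + v * z) * E (v * z) u
    E-unshift v u = begin
      E v u + v * z * E v (u * z)
        ≈⟨ +-congʳ (E-shift v u) ⟩
      E (v * z) u + v * z * u * E (v * z) (u * z) + v * z * E v (u * z)
        ≈⟨ solve 5 (λ e₀ vz u e₁ E₁ → e₀ :+ vz :* u :* e₁ :+ vz :* E₁ := e₀ :+ vz :* (E₁ :+ u :* e₁)) refl _ (v * z) u _ _ ⟩
      E (v * z) u + v * z * (E v (u * z) + u * E (v * z) (u * z))
        ≈⟨ +-congˡ (*-congˡ (E-shift′ v u)) ⟨
      E (v * z) u + v * z * E (v * z) u
        ≈⟨ solve 2 (λ vz e₀ → e₀ :+ vz :* e₀ := (con 1 :+ vz) :* e₀) refl (v * z) _ ⟩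
      (1# + v * z) * E (v * z) u ∎

    -- The part t has the predecessor 0, which is never occupied, hence `false`. Each step
    -- multiplies v by z², once through `E-unshift` at the cost of a factor and once through
    -- `E-shift` for free; this yields the base q⁴ᵗ.
    multiples-chain : ∀ v → chain z false v N z ≈ poch (- (v * z)) (z * z) N * chain₀ z N z
    multiples-chain v = trans
      (poch-iterate (λ v → chain z false v N z) (λ p → chain-cong false N refl p refl) z (z * z) step v N)
      (*-congˡ (chain-zero z false _ N z vanish))
      where
      vanish : v * (z * z) ^ N ≈ 0#
      vanish = trans (*-congˡ (trans (^-distrib-* z z N) (trans (*-congˡ zᴺ≈0) (zeroʳ _)))) (zeroʳ v)
      step : ∀ v → chain z false v N z ≈ (1# + v * z) * chain z false (v * (z * z)) N z
      step v = begin
        chain z false v N z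
          ≈⟨ chain-false-E v z ⟩
        E v z + v * z * E v (z * z)
          ≈⟨ E-unshift v z ⟩
        (1# + v * z) * E (v * z) z
          ≈⟨ *-congˡ (E-shift (v * z) z) ⟩
        (1# + v * z) * (E (v * z * z) z + v * z * z * z * E (v * z * z) (z * z))
          ≈⟨ *-congˡ (chain-false-E (v * z * z) z) ⟨
        (1# + v * z) * chain z false (v * z * z) N z
          ≈⟨ *-congˡ (chain-cong false N refl (*-assoc v z z) refl) ⟩
        (1# + v * z) * chain z false (v * (z * z)) N z ∎

    -- The chain of parts congruent to t/2.

    module _ {w : Carrier} (w²≈z : w * w ≈ z) (wᴺ≈0 : w ^ N ≈ 0#) where

      private
        Ψ : Carrier → Carrier
        Ψ s = E (- (s * s)) w + s * w * E (- (s * s)) (w * z)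

        Ψ-cong : ∀ {s s′} → s ≈ s′ → Ψ s ≈ Ψ s′
        Ψ-cong p = +-cong (E-cong (-‿cong (*-cong p p)) refl) (*-cong (*-congʳ p) (E-cong (-‿cong (*-cong p p)) refl))

        -- Both terms of Ψ are written through e₀ and e₁, values of `E` at v z = -(sw)²; the result
        -- then factors.
        Ψ-step : ∀ s → Ψ s ≈ (1# + s * w) * Ψ (s * - w)
        Ψ-step s = begin
          E v w + sw * E v (w * z)
            ≈⟨ +-congʳ (E-shift v w) ⟩
          e₀ + v * z * w * e₁ + sw * E v (w * z)
            ≈⟨ +-congʳ (+-congˡ (*-congʳ (*-congʳ vz))) ⟩
          e₀ + - (sw * sw) * w * e₁ + sw * E v (w * z)
            -- The solver works over semirings, so negated terms enter it as atoms.
            ≈⟨ solve 5 (λ e₀ m x e₁ y → e₀ :+ m :* x :* e₁ :+ y := y :+ e₀ :+ m :* (x :* e₁)) refl e₀ (- (sw * sw)) w e₁ _ ⟩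
          sw * E v (w * z) + e₀ + - (sw * sw) * (w * e₁)
            ≈⟨ +-congʳ (+-congʳ (*-congˡ E≈)) ⟩
          sw * (e₀ + - (w * e₁)) + e₀ + - (sw * sw) * (w * e₁)
            ≈⟨ +-cong refl (trans (sym (-‿distribˡ-* _ _)) (trans (-‿cong (*-assoc _ _ _)) (trans (-‿distribʳ-* _ _) (*-congˡ (-‿distribʳ-* _ _))))) ⟩
          sw * (e₀ + - (w * e₁)) + e₀ + sw * (sw * - (w * e₁))
            ≈⟨ solve 3 (λ sw e₀ m → sw :* (e₀ :+ m) :+ e₀ :+ sw :* (sw :* m) := (con 1 :+ sw) :* (e₀ :+ sw :* m)) refl sw e₀ (- (w * e₁)) ⟩
          (1# + sw) * (e₀ + sw * - (w * e₁))
            ≈⟨ *-congˡ (+-congˡ (trans (sym (-‿distribʳ-* _ _)) (trans (-‿cong (sym (*-assoc _ _ _))) (-‿distribˡ-* _ _)))) ⟩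
          (1# + sw) * (e₀ + - (sw * w) * e₁)
            ≈⟨ *-congˡ (+-cong (E-cong vz′ refl) (*-cong (trans (-‿distribˡ-* _ _) (*-congʳ (-‿distribʳ-* _ _))) (E-cong vz′ refl))) ⟩
          (1# + sw) * Ψ (s * - w) ∎
          where
          v = - (s * s)
          sw = s * w
          e₀ = E (v * z) w
          e₁ = E (v * z) (w * z)
          vz : v * z ≈ - (sw * sw)
          vz = trans (sym (-‿distribˡ-* _ _)) (-‿cong (trans (*-congˡ (sym w²≈z)) (solve 2 (λ s w → s :* s :* (w :* w) := s :* w :* (s :* w)) refl s w)))
          vz′ : v * z ≈ - (s * - w * (s * - w))
          vz′ = trans vz (-‿cong (sym (trans (*-cong (sym (-‿distribʳ-* s w)) (sym (-‿distribʳ-* s w)))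
            (trans (sym (-‿distribˡ-* _ _)) (trans (-‿cong (sym (-‿distribʳ-* _ _))) (-‿involutive _))))))
          -- This is `E-shift′` at u = w, solved for `E v (w * z)`.
          E≈ : E v (w * z) ≈ e₀ + - (w * e₁)
          E≈ = begin
            E v (w * z)                             ≈⟨ +-identityʳ _ ⟨
            E v (w * z) + 0#                        ≈⟨ +-congˡ (-‿inverseʳ _) ⟨
            E v (w * z) + (w * e₁ + - (w * e₁))     ≈⟨ +-assoc _ _ _ ⟨
            E v (w * z) + w * e₁ + - (w * e₁)       ≈⟨ +-congʳ (E-shift′ v w) ⟨
            e₀ + - (w * e₁)                         ∎

        -w^N≈0 : ∀ s → s * (- w) ^ N ≈ 0#
        -w^N≈0 s = trans (*-congˡ (trans (^-congˡ N -w≈) (trans (^-distrib-* (- 1#) w N) (trans (*-congˡ wᴺ≈0) (zeroʳ _))))) (zeroʳ s)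
          where
          -w≈ : - w ≈ - 1# * w
          -w≈ = trans (-‿cong (sym (*-identityˡ w))) (-‿distribˡ-* 1# w)

        Ψ-product : ∀ s → Ψ s ≈ poch (- (s * w)) (- w) N * chain₀ z N w
        Ψ-product s = trans (poch-iterate Ψ Ψ-cong w (- w) Ψ-step s N) (*-congˡ (begin
          Ψ (s * (- w) ^ N)                  ≈⟨ Ψ-cong (-w^N≈0 s) ⟩
          E _ w + 0# * w * _                 ≈⟨ +-congˡ (trans (*-congʳ (zeroˡ w)) (zeroˡ _)) ⟩
          E _ w + 0#                         ≈⟨ +-identityʳ _ ⟩
          E _ w                              ≈⟨ chain-zero z true _ N w (trans (-‿cong (zeroˡ 0#)) -0#≈0#) ⟩
          chain₀ z N w                       ∎))

      -- Replacing s by -s keeps v = -s² and flips the second term of Ψ, so the two values add up to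
      -- twice the wanted sum; `h` is the inverse of 2.
      half-chain : ∀ s h → h * (1# + 1#) ≈ 1# →
        E (- (s * s)) w ≈ h * (poch (- (s * w)) (- w) N + poch (- (- s * w)) (- w) N) * chain₀ z N w
      half-chain s h 2h≈1 = begin
        e                                   ≈⟨ *-identityˡ e ⟨
        1# * e                              ≈⟨ *-congʳ 2h≈1 ⟨
        h * (1# + 1#) * e                   ≈⟨ solve 2 (λ h e → h :* (con 1 :+ con 1) :* e := h :* (e :+ e)) refl h e ⟩
        h * (e + e)                         ≈⟨ *-congˡ sum≈ ⟨
        h * (Ψ s + Ψ (- s))                 ≈⟨ *-congˡ (+-cong (Ψ-product s) (Ψ-product (- s))) ⟩
        h * (p * d + p′ * d)                ≈⟨ solve 4 (λ h p p′ d → h :* (p :* d :+ p′ :* d) := h :* (p :+ p′) :* d) refl h p p′ d ⟩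
        h * (p + p′) * d                    ∎
        where
        e = E (- (s * s)) w
        p = poch (- (s * w)) (- w) N
        p′ = poch (- (- s * w)) (- w) N
        d = chain₀ z N w
        f = E (- (s * s)) (w * z)
        s²≈ : - s * - s ≈ s * s
        s²≈ = trans (sym (-‿distribˡ-* _ _)) (trans (-‿cong (sym (-‿distribʳ-* _ _))) (-‿involutive _))
        sum≈ : Ψ s + Ψ (- s) ≈ e + e
        sum≈ = begin
          (e + s * w * f) + Ψ (- s)
            ≈⟨ +-congˡ (+-cong (E-cong (-‿cong s²≈) refl) (*-cong refl (E-cong (-‿cong s²≈) refl))) ⟩
          (e + s * w * f) + (e + - s * w * f)
            ≈⟨ solve 5 (λ e s m w f → (e :+ s :* w :* f) :+ (e :+ m :* w :* f) := (e :+ e) :+ (s :+ m) :* (w :* f)) refl e s (- s) w f ⟩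
          (e + e) + (s + - s) * (w * f)
            ≈⟨ +-congˡ (trans (*-congʳ (-‿inverseʳ s)) (zeroˡ _)) ⟩
          (e + e) + 0#
            ≈⟨ +-identityʳ _ ⟩
          e + e ∎

  -- Two coupled chains of opposite residues.

  module _ (z : Carrier) (N : ℕ) (zᴺ≈0 : z ^ suc N ≈ 0#) {a b : Carrier} (ab≈z : a * b ≈ z) where

    open Nilpotent z (suc N) zᴺ≈0

    private
      P : Carrier → Carrier
      P v = E v a * E v b + v * z * (E v (a * z) * E v (b * z))

      P-cong : ∀ {v v′} → v ≈ v′ → P v ≈ P v′
      P-cong p = +-cong (*-cong (E-cong p refl) (E-cong p refl)) (*-cong (*-congʳ p) (*-cong (E-cong p refl) (E-cong p refl)))

      -- Both sides are expressed through E (v z) (u z) and X u = v z² u E (v z) (u z²),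
      -- for u = a and u = b; then it is a semiring identity.
      P-step : ∀ v → P v ≈ (1# + v * z) * P (v * z)
      P-step v = begin
        E v a * E v b + v * z * (E v (a * z) * E v (b * z))
          ≈⟨ +-cong (*-cong (E≈ a) (E≈ b)) (*-cong (*-congˡ (sym ab≈z)) (*-cong (Ez≈ a) (Ez≈ b))) ⟩
        ((1# + a) * e a + X a + v * z * a * e a) * ((1# + b) * e b + X b + v * z * b * e b) + v * (a * b) * ((e a + X a) * (e b + X b))
          ≈⟨ +-congʳ (*-cong (+-congˡ (*-congʳ (*-congʳ (*-congˡ (sym ab≈z))))) (+-congˡ (*-congʳ (*-congʳ (*-congˡ (sym ab≈z)))))) ⟩
        ((1# + a) * e a + X a + v * (a * b) * a * e a) * ((1# + b) * e b + X b + v * (a * b) * b * e b) + v * (a * b) * ((e a + X a) * (e b + X b))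
          ≈⟨ solve 7 (λ v a b e X f Y →
               ((con 1 :+ a) :* e :+ X :+ v :* (a :* b) :* a :* e) :* ((con 1 :+ b) :* f :+ Y :+ v :* (a :* b) :* b :* f) :+ v :* (a :* b) :* ((e :+ X) :* (f :+ Y))
               := (con 1 :+ v :* (a :* b)) :* (((con 1 :+ a) :* e :+ X) :* ((con 1 :+ b) :* f :+ Y) :+ v :* (a :* b) :* (a :* b) :* (e :* f)))
               refl v a b (e a) (X a) (e b) (X b) ⟩
        (1# + v * (a * b)) * (((1# + a) * e a + X a) * ((1# + b) * e b + X b) + v * (a * b) * (a * b) * (e a * e b))
          ≈⟨ *-cong (+-congˡ (*-congˡ ab≈z)) (+-cong (*-cong (sym (E-rec _ a)) (sym (E-rec _ b))) (*-congʳ (*-cong (*-congˡ ab≈z) ab≈z))) ⟩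
        (1# + v * z) * P (v * z) ∎
        where
        e X : Carrier → Carrier
        e u = E (v * z) (u * z)
        X u = v * z * u * z * E (v * z) (u * z * z)
        E≈ : ∀ u → E v u ≈ (1# + u) * e u + X u + v * z * u * e u
        E≈ u = trans (E-shift v u) (+-congʳ (E-rec (v * z) u))
        Ez≈ : ∀ u → E v (u * z) ≈ e u + X u
        Ez≈ u = trans (E-shift v (u * z)) (+-congˡ (*-congʳ (solve 3 (λ v z u → v :* z :* (u :* z) := v :* z :* u :* z) refl v z u)))

    -- With a = Qʳ, b = Qˢ and r + s = t, the two summands belong to r being empty or occupied. An
    -- occupied r gives s a bar of length t, so the chain of s then starts as after an empty
    -- predecessor. Multiplied out, the sum is `P v`.
    pair-chain : ∀ v →
      chain z false v N (a * z) * chain z true v (suc N) b + a * (chain z true v N (a * z) * chain z false v (suc N) b)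
      ≈ poch (- (v * z)) z (suc N) * (chain₀ z (suc N) a * chain₀ z (suc N) b)
    pair-chain v = begin
      A * B + a * (A′ * chain z false v (suc N) b)
        ≈⟨ +-congˡ (*-congˡ (*-congˡ (chain-false z v N b))) ⟩
      A * B + a * (A′ * (B + v * b * B′))
        ≈⟨ solve 7 (λ A A′ B B′ a b v → A :* B :+ a :* (A′ :* (B :+ v :* b :* B′)) := (A :+ a :* con 1 :* A′) :* B :+ v :* (a :* b) :* (A′ :* B′)) refl A A′ B B′ a b v ⟩
      E v a * B + v * (a * b) * (A′ * B′)
        ≈⟨ +-congˡ (*-cong (*-congˡ ab≈z) (*-cong (stable a) (stable b))) ⟩
      P v
        ≈⟨ poch-iterate P P-cong z z P-step v (suc N) ⟩
      poch (- (v * z)) z (suc N) * P (v * z ^ suc N)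
        ≈⟨ *-congˡ (P-cong (uzᴺ≈0 v)) ⟩
      poch (- (v * z)) z (suc N) * (E 0# a * E 0# b + 0# * z * _)
        ≈⟨ *-congˡ (trans (+-congˡ (trans (*-congʳ (zeroˡ z)) (zeroˡ _))) (+-identityʳ _)) ⟩
      poch (- (v * z)) z (suc N) * (E 0# a * E 0# b)
        ≈⟨ *-congˡ (*-cong (chain-zero z true 0# (suc N) a refl) (chain-zero z true 0# (suc N) b refl)) ⟩
      poch (- (v * z)) z (suc N) * (chain₀ z (suc N) a * chain₀ z (suc N) b) ∎
      where
      A = chain z false v N (a * z)
      A′ = chain z true v N (a * z)
      B = chain z true v (suc N) b
      B′ = chain z true v N (b * z)
      -- Length `N` is enough because the argument already carries one factor `z`.
      stable : ∀ u → chain z true v N (u * z) ≈ E v (u * z)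
      stable u = sym (chain-stable z true v N (u * z) (trans (*-assoc _ _ _) (uzᴺ≈0 u)))

-- Sums over subsets of positions.

module Sums {c ℓ} (S : CommutativeRing c ℓ) where

  open CommutativeRing S
  open import Algebra.Solver.Ring.NaturalCoefficients.Default commutativeSemiring using (solve; _:=_; _:+_; _:*_; con)
  open import Relation.Binary.Reasoning.Setoid setoid

  product : (ℕ → Carrier) → List ℕ → Carrier
  product f []       = 1#
  product f (p ∷ ps) = f p * product f ps

  product-cong : ∀ {f g} ps → (∀ k → k ∈ ps → f k ≈ g k) → product f ps ≈ product g ps
  product-cong []       f≈g = refl
  product-cong (p ∷ ps) f≈g = *-cong (f≈g p (here ≡.refl)) (product-cong ps (λ k k∈ → f≈g k (there k∈)))

  product-++ : ∀ f ps qs → product f (ps ++ qs) ≈ product f ps * product f qs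
  product-++ f []       qs = sym (*-identityˡ _)
  product-++ f (p ∷ ps) qs = trans (*-congˡ (product-++ f ps qs)) (sym (*-assoc _ _ _))

  product-↭ : ∀ f {ps qs} → ps ↭ qs → product f ps ≈ product f qs
  product-↭ f _↭_.refl        = refl
  product-↭ f (prep x p)      = *-congˡ (product-↭ f p)
  product-↭ f (swap x y p)    = trans (*-congˡ (*-congˡ (product-↭ f p))) (solve 3 (λ x y p → x :* (y :* p) := y :* (x :* p)) refl _ _ _)
  product-↭ f (_↭_.trans p q) = trans (product-↭ f p) (product-↭ f q)

  total : {A : Set} → (A → Carrier) → List A → Carrier
  total f []       = 0#
  total f (a ∷ as) = f a + total f as

  total-cong : ∀ {A : Set} {f g : A → Carrier} as → (∀ a → a ∈ as → f a ≈ g a) → total f as ≈ total g as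
  total-cong []       f≈g = refl
  total-cong (a ∷ as) f≈g = +-cong (f≈g a (here ≡.refl)) (total-cong as (λ b b∈ → f≈g b (there b∈)))

  total-++ : ∀ {A : Set} (f : A → Carrier) as bs → total f (as ++ bs) ≈ total f as + total f bs
  total-++ f []       bs = sym (+-identityˡ _)
  total-++ f (a ∷ as) bs = trans (+-congˡ (total-++ f as bs)) (sym (+-assoc _ _ _))

  total-map : ∀ {A B : Set} (f : B → Carrier) (g : A → B) as → total f (map g as) ≈ total (f ∘ g) as
  total-map f g []       = refl
  total-map f g (a ∷ as) = +-congˡ (total-map f g as)

  -- The summand takes an occupation instead of a list, so that the positions can be reordered and
  -- split into residue classes.
  subsetSum : List ℕ → (Occupation → Carrier) → Carrier
  subsetSum []       f = f ∅
  subsetSum (p ∷ ps) f = subsetSum ps f + subsetSum ps (f ∘ set p)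

  total-strictUpTo : ∀ n f → total (f ∘ occupied) (strictUpTo n) ≈ subsetSum (down n) f
  total-strictUpTo zero    f = +-identityʳ _
  total-strictUpTo (suc n) f = trans (total-++ _ (strictUpTo n) _)
    (+-cong (total-strictUpTo n f) (trans (total-map _ (suc n ∷_) (strictUpTo n)) (total-strictUpTo n (f ∘ set (suc n)))))

  -- Dependence on the positions in `ps` only; it also stands in for function extensionality.
  Reads : List ℕ → (Occupation → Carrier) → Set ℓ
  Reads ps f = ∀ {σ τ} → (∀ k → k ∈ ps → σ k ≡ τ k) → f σ ≈ f τ

  set-cong : ∀ p k {b b′ : Bool} → b ≡ b′ → (if k ≡ᵇ p then true else b) ≡ (if k ≡ᵇ p then true else b′)
  set-cong p k e = ≡.cong (if k ≡ᵇ p then true else_) e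

  Reads-set : ∀ {ps f} p → Reads ps f → Reads ps (f ∘ set p)
  Reads-set p reads σ≡τ = reads (λ k k∈ → set-cong p k (σ≡τ k k∈))

  SupportedOn : List ℕ → Occupation → Set
  SupportedOn ps σ = ∀ k → k ∉ ps → σ k ≡ false

  subsetSum-cong : ∀ ps {f g} → (∀ σ → SupportedOn ps σ → f σ ≈ g σ) → subsetSum ps f ≈ subsetSum ps g
  subsetSum-cong []       f≈g = f≈g ∅ (λ _ _ → ≡.refl)
  subsetSum-cong (p ∷ ps) f≈g = +-cong
    (subsetSum-cong ps (λ σ s → f≈g σ (λ k k∉ → s k (k∉ ∘ there))))
    (subsetSum-cong ps (λ σ s → f≈g (set p σ) (λ k k∉ →
      ≡.trans (set-other σ (λ k≡p → k∉ (here k≡p))) (s k (k∉ ∘ there)))))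

  -- Two exchanged `set`s give occupations that agree only pointwise, so `f` has to respect
  -- pointwise equality.
  subsetSum-↭ : ∀ {ps qs f} → (∀ {σ τ} → (∀ k → σ k ≡ τ k) → f σ ≈ f τ) → ps ↭ qs → subsetSum ps f ≈ subsetSum qs f
  subsetSum-↭ ext _↭_.refl        = refl
  subsetSum-↭ ext (prep x p)      = +-cong (subsetSum-↭ ext p) (subsetSum-↭ (λ e → ext (λ k → set-cong x k (e k))) p)
  subsetSum-↭ {f = f} ext (swap {xs} {ys} x y p) = trans
    (+-cong (+-cong (subsetSum-↭ ext p) (subsetSum-↭ (λ e → ext (λ k → set-cong y k (e k))) p))
            (+-cong (subsetSum-↭ (λ e → ext (λ k → set-cong x k (e k))) p)
                    (trans (subsetSum-↭ (λ e → ext (λ k → set-cong x k (set-cong y k (e k)))) p)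
                           (subsetSum-cong ys (λ σ _ → ext (λ k → commute (k ≡ᵇ x) (k ≡ᵇ y) (σ k)))))))
    (solve 4 (λ a b c d → (a :+ b) :+ (c :+ d) := (a :+ c) :+ (b :+ d)) refl _ _ _ _)
    where
    commute : ∀ a b c → (if a then true else (if b then true else c)) ≡ (if b then true else (if a then true else c))
    commute true  true  c = ≡.refl
    commute true  false c = ≡.refl
    commute false b     c = ≡.refl
  subsetSum-↭ ext (_↭_.trans p q) = trans (subsetSum-↭ ext p) (subsetSum-↭ ext q)

  subsetSum-* : ∀ ps a f → subsetSum ps (λ σ → a * f σ) ≈ a * subsetSum ps f
  subsetSum-* []       a f = refl
  subsetSum-* (p ∷ ps) a f = trans (+-cong (subsetSum-* ps a f) (subsetSum-* ps a (f ∘ set p))) (sym (distribˡ a _ _))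

  -- The distributive law: filling `ps` leaves `g` alone and filling `qs` leaves `f` alone. The
  -- lists `as` and `bs` stay fixed while `ps` shrinks in the induction.
  subsetSum-++ : ∀ {as bs} ps qs {f g} → Reads as f → Reads bs g → Disjoint ps bs → Disjoint qs as →
                 subsetSum (ps ++ qs) (λ σ → f σ * g σ) ≈ subsetSum ps f * subsetSum qs g
  subsetSum-++ [] qs {f} {g} rf rg d e = trans
    (subsetSum-cong qs (λ σ s → *-congʳ (rf (λ k k∈ → s k (λ k∈qs → e k k∈qs k∈)))))
    (subsetSum-* qs (f ∅) g)
  subsetSum-++ (p ∷ ps) qs {f} {g} rf rg d e = trans
    (+-cong (subsetSum-++ ps qs rf rg (λ k → d k ∘ there) e)
            (trans (subsetSum-cong (ps ++ qs) (λ σ _ → *-congˡ (rg (λ k k∈ → set-other {p} {k} σ (λ { ≡.refl → d p (here ≡.refl) k∈ })))))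
                   (subsetSum-++ ps qs (Reads-set p rf) rg (λ k → d k ∘ there) e)))
    (sym (distribʳ _ _ _))

  -- Weights of strict partitions, factored over residue classes modulo `t`.

  module Bars (v Q : Carrier) (t : ℕ) (0<t : 0 < t) where

    open Chains S
    open import Algebra.Properties.Ring ring using (-‿distribˡ-*; -‿involutive)
    open import Algebra.Properties.Semiring.Exp semiring using (_^_; ^-congˡ; ^-homo-*)
    open import Algebra.Properties.CommutativeSemiring.Exp commutativeSemiring using (^-distrib-*)

    z : Carrier
    z = Q ^ t

    -- pred is the state of the predecessor of k in its chain.
    local : Bool → ℕ → Bool → Carrier
    local pred k self = if self then weight pred v (Q ^ k) else 1#

    -- A bar acts as an empty predecessor: it means that k - t is empty if t ≤ k, and that t - k is
    -- an occupied smaller position otherwise.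
    position : Occupation → ℕ → Carrier
    position σ k = local (not (bar t k σ)) k (σ k)

    position-cong : ∀ {σ τ} k → 0 < k → (∀ j → j ≤ k → σ j ≡ τ j) → position σ k ≈ position τ k
    position-cong k 0<k σ≡τ = reflexive (≡.cong₂ (λ b → local (not b) k) (bar-cong 0<t 0<k (λ j j<k → σ≡τ j (<⇒≤ j<k))) (σ≡τ k ≤-refl))

    -- Each position sees the state of its predecessor in the list, so summing over subsets gives
    -- `chain`.
    runProduct : Bool → List ℕ → Occupation → Carrier
    runProduct b []       σ = 1#
    runProduct b (p ∷ ps) σ = local b p (σ p) * runProduct (σ p) ps σ

    runProduct-reads : ∀ b ps → Reads ps (runProduct b ps)
    runProduct-reads b []       σ≡τ = refl
    runProduct-reads b (p ∷ ps) {σ} {τ} σ≡τ rewrite σ≡τ p (here ≡.refl) =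
      *-congˡ (runProduct-reads (τ p) ps (λ k k∈ → σ≡τ k (there k∈)))

    runProduct-true : ∀ b p ps σ → Unique (p ∷ ps) →
                      runProduct b (p ∷ ps) (set p σ) ≈ weight b v (Q ^ p) * runProduct true ps σ
    runProduct-true b p ps σ (p∉ ∷ _) rewrite set-same p σ =
      *-congˡ (runProduct-reads true ps (λ k k∈ → set-other {p} {k} σ (λ { ≡.refl → All.lookup p∉ k∈ ≡.refl })))

    runProduct-false : ∀ b p ps σ → Unique (p ∷ ps) → SupportedOn ps σ →
                       runProduct b (p ∷ ps) σ ≈ runProduct false ps σ
    runProduct-false b p ps σ (p∉ ∷ _) s rewrite s p (λ p∈ → All.lookup p∉ p∈ ≡.refl) = *-identityˡ _

    chain-progression : ∀ b N r → chain z b v N (Q ^ r * z) ≈ chain z b v N (Q ^ (r +ᴺ t))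
    chain-progression b N r = chain-cong b N refl refl (sym (^-homo-* Q r t))

    progression-Unique : ∀ N r → Unique (progression t N r)
    progression-Unique zero    r = []
    progression-Unique (suc N) r =
      All.tabulate (λ k∈ r≡k → <⇒≢ (<-≤-trans (m<m+n r 0<t) (progression-≥ t N k∈)) r≡k) ∷ progression-Unique N (r +ᴺ t)

    subsetSum-runProduct : ∀ b N r → subsetSum (progression t N r) (runProduct b (progression t N r)) ≈ chain z b v N (Q ^ r)
    subsetSum-runProduct b zero    r = refl
    subsetSum-runProduct b (suc N) r = +-cong
      (trans (subsetSum-cong ps (λ σ s → runProduct-false b r ps σ (progression-Unique (suc N) r) s))
        (trans (subsetSum-runProduct false N (r +ᴺ t)) (sym (chain-progression false N r))))
      (trans (subsetSum-cong ps (λ σ _ → runProduct-true b r ps σ (progression-Unique (suc N) r)))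
        (trans (subsetSum-* ps _ _) (*-congˡ (trans (subsetSum-runProduct true N (r +ᴺ t)) (sym (chain-progression true N r))))))
      where ps = progression t N (r +ᴺ t)

    onePlus : ℕ → Carrier
    onePlus k = 1# + Q ^ k

    chain₀-progression : ∀ N r → chain₀ z N (Q ^ r) ≈ product onePlus (progression t N r)
    chain₀-progression zero    r = refl
    chain₀-progression (suc N) r = *-congˡ (trans (chain₀-cong N (sym (^-homo-* Q r t))) (chain₀-progression N (r +ᴺ t)))
      where
      chain₀-cong : ∀ N {u u′} → u ≈ u′ → chain₀ z N u ≈ chain₀ z N u′
      chain₀-cong zero    p = refl
      chain₀-cong (suc N) p = *-cong (+-congˡ p) (chain₀-cong N (*-congʳ p))

    -- From `r + t` on, the bar of a position k is decided by k - t, the preceding entry.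
    position-progression : ∀ σ N r → product (position σ) (progression t N (r +ᴺ t)) ≈ runProduct (σ r) (progression t N (r +ᴺ t)) σ
    position-progression σ zero    r = refl
    position-progression σ (suc N) r = *-cong (reflexive (≡.cong (λ b → local b (r +ᴺ t) (σ (r +ᴺ t))) pred≡)) (position-progression σ N (r +ᴺ t))
      where
      pred≡ : not (bar t (r +ᴺ t) σ) ≡ σ r
      pred≡ = ≡.trans
        (≡.cong (λ b → not (if b then not (σ (r +ᴺ t ∸ t)) else σ (t ∸ (r +ᴺ t)) ∧ (t ∸ (r +ᴺ t) <ᵇ r +ᴺ t))) (dec-true (t ≤? r +ᴺ t) (m≤n+m t r)))
        (≡.trans (not-involutive _) (≡.cong σ (m+n∸n≡m r t)))

    position-first : ∀ σ N r b → not (bar t r σ) ≡ b → product (position σ) (progression t (suc N) r) ≈ runProduct b (progression t (suc N) r) σ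
    position-first σ N r b e = *-cong (reflexive (≡.cong (λ b → local b r (σ r)) e)) (position-progression σ N r)

    bar-short : ∀ {r s} σ → 0 < s → r +ᴺ s ≡ t → bar t r σ ≡ σ s ∧ (s <ᵇ r)
    bar-short {r} {s} σ 0<s ≡.refl = ≡.trans
      (≡.cong (if_then not (σ (r ∸ t)) else (σ (t ∸ r) ∧ (t ∸ r <ᵇ r))) (dec-false (t ≤? r) (<⇒≱ (m<m+n r 0<s))))
      (≡.cong (λ k → σ k ∧ (k <ᵇ r)) (m+n∸m≡n r s))

    -- Positions that interact only among themselves, whose sum is `factor` times the value it would
    -- have at v = 0. The condition on position 0 serves the multiples of `t`, where 0 is the
    -- predecessor of `t`.
    record Class (ps : List ℕ) (factor : Carrier) : Set (c ⊔ ℓ) where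
      field
        classWeight : Occupation → Carrier
        reads       : Reads ps classWeight
        agrees      : ∀ σ → σ 0 ≡ false → product (position σ) ps ≈ classWeight σ
        evaluates   : subsetSum ps classWeight ≈ factor * product onePlus ps

    open Class

    emptyClass : Class [] 1#
    emptyClass = record { classWeight = λ _ → 1# ; reads = λ _ → refl ; agrees = λ _ _ → refl ; evaluates = sym (*-identityˡ _) }

    _⊎ᶜ_ : ∀ {ps qs a b} → Class ps a → Class qs b → Disjoint ps qs → Class (ps ++ qs) (a * b)
    _⊎ᶜ_ {ps} {qs} {a} {b} C D disjoint = record
      { classWeight = λ σ → classWeight C σ * classWeight D σ
      ; reads = λ σ≡τ → *-cong (reads C (λ k k∈ → σ≡τ k (∈-++⁺ˡ k∈))) (reads D (λ k k∈ → σ≡τ k (∈-++⁺ʳ ps k∈)))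
      ; agrees = λ σ e → trans (product-++ _ ps qs) (*-cong (agrees C σ e) (agrees D σ e))
      ; evaluates = trans (subsetSum-++ ps qs (reads C) (reads D) disjoint (λ k k∈qs k∈ps → disjoint k k∈ps k∈qs))
          (trans (*-cong (evaluates C) (evaluates D))
            (trans (solve 4 (λ a x b y → (a :* x) :* (b :* y) := (a :* b) :* (x :* y)) refl a _ b _)
              (*-congˡ (sym (product-++ _ ps qs)))))
      }

    term : List ℕ → Carrier
    term λs = (1# + v) ^ n̂ t (doubled λs) * Q ^ sum λs

    -- Induction on the bound: removing the largest part removes the hooks of the first row, and by
    -- `bar-cong` the smaller positions do not see the difference.
    term-positions : ∀ m {λs} → StrictBelow m λs → term λs ≈ product (position (occupied λs)) (down m)
    term-positions zero    [] = *-identityˡ _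
    term-positions (suc m) [] = trans (term-positions m []) (sym (*-identityˡ _))
    term-positions (suc m) {suc k ∷ ks} (s≤s k≤m ∷ s) = cases (m≤n⇒m<n∨m≡n k≤m)
      where
      cases : k < m ⊎ k ≡ m → term (suc k ∷ ks) ≈ product (position (occupied (suc k ∷ ks))) (down (suc m))
      -- Position `suc m` is empty and contributes the factor 1.
      cases (inj₁ k<m) = trans (term-positions m (k<m ∷ s)) (trans (sym (*-identityˡ _))
        (*-congʳ (reflexive (≡.cong (λ b → local (not (bar t (suc m) (occupied (suc k ∷ ks)))) (suc m) b) (≡.sym (occupied-beyond (k<m ∷ s) (suc m) ≤-refl))))))
      cases (inj₂ ≡.refl) = begin
        (1# + v) ^ n̂ t (doubled (suc k ∷ ks)) * (Q ^ (suc k +ᴺ sum ks))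
          ≈⟨ *-cong (trans (reflexive (≡.cong ((1# + v) ^_) (≡.trans (n̂-doubled t s) (≡.cong (_+ᴺ n̂ t (doubled ks)) (firstRowHooks-bar 0<t s)))))
                           (^-homo-* (1# + v) (bit b) _))
                    (^-homo-* Q (suc k) (sum ks)) ⟩
        ((1# + v) ^ bit b * (1# + v) ^ n̂ t (doubled ks)) * (Q ^ suc k * Q ^ sum ks)
          ≈⟨ solve 4 (λ x y q r → (x :* y) :* (q :* r) := (q :* x) :* (y :* r)) refl _ _ _ _ ⟩
        (Q ^ suc k * (1# + v) ^ bit b) * term ks
          ≈⟨ *-cong (*-congˡ (bar-weight b)) (term-positions k s) ⟩
        weight (not b) v (Q ^ suc k) * product (position (occupied ks)) (down k)
          ≈⟨ *-cong (trans (reflexive (≡.cong (λ c → weight (not c) v (Q ^ suc k)) (bar-cong 0<t (s≤s z≤n) below)))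
                           (reflexive (≡.cong (λ c → local (not (bar t (suc k) σ)) (suc k) c) (≡.sym (set-same (suc k) (occupied ks))))))
                    (product-cong (down k) (λ j j∈ → position-cong j (down-> k j∈) (λ i i≤j → below i (s≤s (≤-trans i≤j (down-≤ k j∈)))))) ⟩
        position σ (suc k) * product (position σ) (down k) ∎
        where
        σ = occupied (suc k ∷ ks)
        b = bar t (suc k) (occupied ks)
        below : ∀ j → j < suc k → occupied ks j ≡ σ j
        below j j<1+k = ≡.sym (set-other (occupied ks) (<⇒≢ j<1+k))
        bar-weight : ∀ b → (1# + v) ^ bit b ≈ (if not b then 1# else 1# + v)
        bar-weight true  = *-identityʳ _
        bar-weight false = refl
        down-> : ∀ m {j} → j ∈ down m → 0 < j
        down-> m {zero}  j∈ = contradiction j∈ (0∉down m)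
        down-> m {suc j} j∈ = s≤s z≤n

    -- The order of `down M` suits the enumeration of strict partitions, that of `ps` the residue
    -- classes.
    total-term : ∀ M {ps a} → down M ↭ ps → Class ps a → total term (strictUpTo M) ≈ a * product onePlus (down M)
    total-term M {ps} {a} M↭ps C = begin
      total term (strictUpTo M)
        ≈⟨ total-cong (strictUpTo M) (λ λs λs∈ → term-positions M (strictUpTo-below M λs∈)) ⟩
      total (λ λs → product (position (occupied λs)) (down M)) (strictUpTo M)
        ≈⟨ total-strictUpTo M (λ σ → product (position σ) (down M)) ⟩
      subsetSum (down M) (λ σ → product (position σ) (down M))
        ≈⟨ subsetSum-cong (down M) (λ σ s → trans (product-↭ (position σ) M↭ps) (agrees C σ (s 0 (0∉down M)))) ⟩
      subsetSum (down M) (classWeight C)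
        ≈⟨ subsetSum-↭ (λ σ≡τ → reads C (λ k _ → σ≡τ k)) M↭ps ⟩
      subsetSum ps (classWeight C)
        ≈⟨ evaluates C ⟩
      a * product onePlus ps
        ≈⟨ *-congˡ (product-↭ onePlus M↭ps) ⟨
      a * product onePlus (down M) ∎

    -- Evaluation of the residue classes for nilpotent `Q`.

    module Factors (N : ℕ) (Qᴺ≈0 : Q ^ suc N ≈ 0#) where

      power-vanishes : ∀ {r} → 0 < r → (Q ^ r) ^ suc N ≈ 0#
      power-vanishes {suc r} _ = trans (^-distrib-* Q (Q ^ r) (suc N)) (trans (*-congʳ Qᴺ≈0) (zeroˡ _))

      open Nilpotent z (suc N) (power-vanishes 0<t)

      multiplesClass : Class (progression t (suc N) t) (poch (- (v * z)) (z * z) (suc N))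
      multiplesClass = record
        { classWeight = runProduct false ps
        ; reads = runProduct-reads false ps
        -- The class starts at `0 + t`, so its first predecessor is position 0.
        ; agrees = λ σ σ0 → trans (position-progression σ (suc N) 0) (reflexive (≡.cong (λ b → runProduct b ps σ) σ0))
        ; evaluates = trans (subsetSum-runProduct false (suc N) t) (trans (multiples-chain v) (*-congˡ (chain₀-progression (suc N) t)))
        }
        where ps = progression t (suc N) t

      halfClass : ∀ {h} → 0 < h → h +ᴺ h ≡ t → ∀ ½ s → ½ * (1# + 1#) ≈ 1# → v ≈ - (s * s) →
        Class (progression t (suc N) h) (½ * (poch (- (s * Q ^ h)) (- Q ^ h) (suc N) + poch (- (- s * Q ^ h)) (- Q ^ h) (suc N)))
      halfClass {h} 0<h h+h≡t ½ s ½*2≈1 v≈ = record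
        { classWeight = runProduct true ps
        ; reads = runProduct-reads true ps
        -- A bar at `h` would require a second part `h`, which the strict inequality in `bar`
        -- excludes; the chain starts as after an occupied position.
        ; agrees = λ σ _ → position-first σ N h true (≡.cong not (≡.trans (bar-short σ 0<h h+h≡t) (≡.trans (≡.cong (σ h ∧_) (<ᵇ-false {h} ≤-refl)) (∧-zeroʳ _))))
        ; evaluates = trans (subsetSum-runProduct true (suc N) h)
            (trans (E-cong v≈ refl) (trans (half-chain w²≈z (power-vanishes 0<h) s ½ ½*2≈1) (*-congˡ (chain₀-progression (suc N) h))))
        }
        where
        ps = progression t (suc N) h
        w²≈z : Q ^ h * Q ^ h ≈ z
        w²≈z = trans (sym (^-homo-* Q h h)) (reflexive (≡.cong (Q ^_) h+h≡t))

      pairClass : ∀ {r s} → IsMirrored t (r , s) → Unique (progression t (suc N) r ++ progression t (suc N) s) →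
        Class (progression t (suc N) r ++ progression t (suc N) s) (poch (- (v * z)) z (suc N))
      pairClass {r} {s} (0<r , r<s , r+s≡t) (r∉ ∷ unique) = record
        { classWeight = F
        ; reads = F-reads
        ; agrees = λ σ _ → trans (product-++ _ (r ∷ ps) qs) (*-cong
            -- The bar of length r + s = t is counted at the larger `s`, so `r` has none.
            (position-first σ N r true (≡.cong not (≡.trans (bar-short σ (≤-trans (s≤s z≤n) r<s) r+s≡t) (≡.trans (≡.cong (σ s ∧_) (<ᵇ-false (<⇒≤ r<s))) (∧-zeroʳ _)))))
            -- At `s` there is a bar exactly when `r` is occupied.
            (position-first σ N s (not (σ r)) (≡.cong not (≡.trans (bar-short σ 0<r (≡.trans (ℕ.+-comm s r) r+s≡t)) (≡.trans (≡.cong (σ r ∧_) (<ᵇ-true r<s)) (∧-identityʳ _))))))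
        ; evaluates = begin
            subsetSum (ps ++ qs) F + subsetSum (ps ++ qs) (F ∘ set r)
              ≈⟨ +-cong (subsetSum-cong (ps ++ qs) F-false) (trans (subsetSum-cong (ps ++ qs) F-true) (subsetSum-* (ps ++ qs) (Q ^ r) _)) ⟩
            subsetSum (ps ++ qs) (λ σ → runProduct false ps σ * runProduct true qs σ) + Q ^ r * subsetSum (ps ++ qs) (λ σ → runProduct true ps σ * runProduct false qs σ)
              ≈⟨ +-cong (split false true) (*-congˡ (split true false)) ⟩
            chain z false v N (Q ^ r * z) * chain z true v (suc N) (Q ^ s) + Q ^ r * (chain z true v N (Q ^ r * z) * chain z false v (suc N) (Q ^ s))
              ≈⟨ pair-chain z N (power-vanishes 0<t) (trans (sym (^-homo-* Q r s)) (reflexive (≡.cong (Q ^_) r+s≡t))) v ⟩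
            poch (- (v * z)) z (suc N) * (chain₀ z (suc N) (Q ^ r) * chain₀ z (suc N) (Q ^ s))
              ≈⟨ *-congˡ (trans (*-cong (chain₀-progression (suc N) r) (chain₀-progression (suc N) s)) (sym (product-++ _ (r ∷ ps) qs))) ⟩
            poch (- (v * z)) z (suc N) * product onePlus (r ∷ ps ++ qs) ∎
        }
        where
        ps = progression t N (r +ᴺ t)
        qs = progression t (suc N) s
        -- The state of `r` is read by both chains, so the sum factors only after splitting on it.
        F : Occupation → Carrier
        F σ = runProduct true (r ∷ ps) σ * runProduct (not (σ r)) qs σ
        F-reads : Reads (r ∷ ps ++ qs) F
        F-reads {σ} {τ} σ≡τ = *-cong (runProduct-reads true (r ∷ ps) (λ k k∈ → σ≡τ k (∈-++⁺ˡ k∈)))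
          (trans (runProduct-reads (not (σ r)) qs (λ k k∈ → σ≡τ k (∈-++⁺ʳ (r ∷ ps) k∈)))
                 (reflexive (≡.cong (λ b → runProduct (not b) qs τ) (σ≡τ r (here ≡.refl)))))
        r∉ps++qs : r ∉ ps ++ qs
        r∉ps++qs r∈ = All.lookup r∉ r∈ ≡.refl
        F-false : ∀ σ → SupportedOn (ps ++ qs) σ → F σ ≈ runProduct false ps σ * runProduct true qs σ
        F-false σ s with σ r | s r r∉ps++qs
        ... | _ | ≡.refl = *-congʳ (*-identityˡ _)
        F-true : ∀ σ → SupportedOn (ps ++ qs) σ → F (set r σ) ≈ Q ^ r * (runProduct true ps σ * runProduct false qs σ)
        F-true σ s rewrite set-same r σ = trans
          (*-cong (*-cong (*-identityʳ (Q ^ r)) (runProduct-reads true ps (λ k k∈ → unset k (∈-++⁺ˡ k∈))))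
                  (runProduct-reads false qs (λ k k∈ → unset k (∈-++⁺ʳ ps k∈))))
          (*-assoc _ _ _)
          where
          unset : ∀ k → k ∈ ps ++ qs → set r σ k ≡ σ k
          unset k k∈ = set-other {r} {k} σ (λ { ≡.refl → r∉ps++qs k∈ })
        split : ∀ b b′ → subsetSum (ps ++ qs) (λ σ → runProduct b ps σ * runProduct b′ qs σ)
                         ≈ chain z b v N (Q ^ r * z) * chain z b′ v (suc N) (Q ^ s)
        split b b′ = trans
          (subsetSum-++ ps qs (runProduct-reads b ps) (runProduct-reads b′ qs) (Unique⇒Disjoint ps unique) (λ k k∈qs k∈ps → Unique⇒Disjoint ps unique k k∈ps k∈qs))
          (*-cong (trans (subsetSum-runProduct b N (r +ᴺ t)) (sym (chain-progression b N r))) (subsetSum-runProduct b′ (suc N) s))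

      pairsClass : ∀ {rs} → All (IsMirrored t) rs → Unique (concatMap (progression t (suc N)) (flatten rs)) →
        Class (concatMap (progression t (suc N)) (flatten rs)) (poch (- (v * z)) z (suc N) ^ length rs)
      pairsClass []       _ = emptyClass
      pairsClass {(r , s) ∷ rs} (m ∷ ms) u =
        ≡.subst (λ ps → Class ps (poch (- (v * z)) z (suc N) ^ suc (length rs))) (++-assoc P P′ rest)
          ((pairClass m (Unique-++⁻ˡ (P ++ P′) u′) ⊎ᶜ pairsClass ms (Unique-++⁻ʳ (P ++ P′) u′)) (Unique⇒Disjoint (P ++ P′) u′))
        where
        P  = progression t (suc N) r
        P′ = progression t (suc N) s
        rest = concatMap (progression t (suc N)) (flatten rs)
        u′ : Unique ((P ++ P′) ++ rest)
        u′ = ≡.subst Unique (≡.sym (++-assoc P P′ rest)) u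

      private
        -- A multiple of `t`, so that every residue class has exactly `suc N` positions.
        M : ℕ
        M = suc N *ᴺ t

        -- The residues 1, ..., t are t itself, the `e` middle ones (t/2 for e = 1, none for e = 0)
        -- and `k` pairs ± r.
        positions↭ : ∀ e k → t ≡ suc (k *ᴺ 2 +ᴺ e) →
                     down M ↭ concatMap (progression t (suc N)) (t ∷ segment k e ++ flatten (mirrored e 0 k))
        positions↭ e k t≡ = ↭-trans (down↭segment M) (↭-trans (segment↭progressions t (suc N) 0)
          (concatMap-↭ (progression t (suc N)) (≡.subst (λ n → segment 0 n ↭ n ∷ segment k e ++ flatten (mirrored e 0 k)) (≡.sym t≡)
            (↭-trans (segment-last 0 (k *ᴺ 2 +ᴺ e)) (prep _ (segment↭mirrored e 0 k))))))

        mirrored-t : ∀ e k → t ≡ suc (k *ᴺ 2 +ᴺ e) → All (IsMirrored t) (mirrored e 0 k)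
        mirrored-t e k t≡ = ≡.subst (λ n → All (IsMirrored n) (mirrored e 0 k)) (≡.sym t≡) (mirrored-sum e 0 k)

      total-odd : ∀ k → t ≡ suc (k *ᴺ 2 +ᴺ 0) →
        total term (strictUpTo M) ≈ poch (- (v * z)) (z * z) (suc N) * poch (- (v * z)) z (suc N) ^ k * product onePlus (down M)
      total-odd k t≡ = trans (total-term M (positions↭ 0 k t≡)
        ((multiplesClass ⊎ᶜ pairsClass (mirrored-t 0 k t≡) (Unique-++⁻ʳ ps unique)) (Unique⇒Disjoint ps unique)))
        (*-congʳ (*-congˡ (reflexive (≡.cong (_ ^_) (length-mirrored 0 0 k)))))
        where
        ps = progression t (suc N) t
        unique = Unique-resp-↭ (positions↭ 0 k t≡) (down-Unique M)

      total-even : ∀ k → t ≡ suc (k *ᴺ 2 +ᴺ 1) → ∀ ½ s → ½ * (1# + 1#) ≈ 1# → v ≈ - (s * s) →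
        total term (strictUpTo M) ≈
          poch (- (v * z)) (z * z) (suc N)
          * (½ * (poch (- (s * Q ^ suc k)) (- Q ^ suc k) (suc N) + poch (- (- s * Q ^ suc k)) (- Q ^ suc k) (suc N)) * poch (- (v * z)) z (suc N) ^ k)
          * product onePlus (down M)
      total-even k t≡ ½ s ½*2≈1 v≈ = trans (total-term M (positions↭ 1 k t≡)
        ((multiplesClass ⊎ᶜ
          (halfClass (s≤s z≤n) h+h≡t ½ s ½*2≈1 v≈ ⊎ᶜ pairsClass (mirrored-t 1 k t≡) (Unique-++⁻ʳ qs unique′)) (Unique⇒Disjoint qs unique′))
          (Unique⇒Disjoint ps unique)))
        (*-congʳ (*-congˡ (*-congˡ (reflexive (≡.cong (_ ^_) (length-mirrored 1 0 k))))))
        where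
        ps = progression t (suc N) t
        qs = progression t (suc N) (suc k)
        unique = Unique-resp-↭ (positions↭ 1 k t≡) (down-Unique M)
        unique′ = Unique-++⁻ʳ ps unique
        h+h≡t : suc k +ᴺ suc k ≡ t
        h+h≡t = ≡.trans (h+h k) (≡.sym t≡)
          where
          h+h : ∀ k → suc k +ᴺ suc k ≡ suc (k *ᴺ 2 +ᴺ 1)
          h+h = solve-∀

    product-onePlus : ∀ M → product onePlus (down M) ≈ poch (- Q) Q M
    product-onePlus zero    = refl
    product-onePlus (suc M) = trans (*-comm _ _) (*-cong (product-onePlus M)
      (+-congˡ (trans (sym (-‿involutive _)) (-‿cong (-‿distribˡ-* Q (Q ^ M))))))

-- The ring of power series modulo qⁿ⁺¹.

module TruncatedSeries {c ℓ} (R : CommutativeRing c ℓ) where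

  open CommutativeRing R
  open PowerSeries R
  open import Algebra.Properties.CommutativeMonoid.Sum +-commutativeMonoid using (sum-cong-≋)
  open import Algebra.Properties.Ring ring using (-0#≈0#; -‿involutive; -‿+-comm)
  open import Algebra.Properties.Semiring.Exp semiring using (_^_)
  open import Algebra.Solver.Ring.NaturalCoefficients.Default commutativeSemiring using (solve; _:=_; _:+_; _:*_; con)
  open import Relation.Binary.Reasoning.Setoid setoid

  infix 4 _≈[_]_
  _≈[_]_ : Series → ℕ → Series → Set ℓ
  f ≈[ n ] g = ∀ m → m ≤ n → f m ≈ g m

  *ˢ-cong : ∀ n {f f′ g g′} → f ≈[ n ] f′ → g ≈[ n ] g′ → f *ˢ g ≈[ n ] f′ *ˢ g′
  *ˢ-cong n p q m m≤n = sum-cong-≋ {suc m} (λ i →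
    *-cong (p (toℕ i) (≤-trans (toℕ≤pred[n] i) m≤n)) (q (m ∸ toℕ i) (≤-trans (m∸n≤m m (toℕ i)) m≤n)))

  *ˢ-cong-≈ˢ : ∀ {f f′ g g′} → f ≈ˢ f′ → g ≈ˢ g′ → f *ˢ g ≈ˢ f′ *ˢ g′
  *ˢ-cong-≈ˢ p q n = *ˢ-cong n (λ m _ → p m) (λ m _ → q m) n ≤-refl

  *ˢ-congˡ-≈ˢ : ∀ f {g g′} → g ≈ˢ g′ → f *ˢ g ≈ˢ f *ˢ g′
  *ˢ-congˡ-≈ˢ f = *ˢ-cong-≈ˢ {f} (λ _ → refl)

  -- The coefficient at `suc n` unfolds to `f 0 * g (suc n)` plus the coefficient at `n` of
  -- `(f ∘ suc) *ˢ g`; the laws of multiplication are inductions along this, with `f` varying.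
  *ˢ-zeroˡ : ∀ {f} g → (∀ n → f n ≈ 0#) → f *ˢ g ≈ˢ 0ˢ
  *ˢ-zeroˡ g f≈0 zero    = trans (+-identityʳ _) (trans (*-congʳ (f≈0 0)) (zeroˡ _))
  *ˢ-zeroˡ g f≈0 (suc n) = trans (+-cong (trans (*-congʳ (f≈0 0)) (zeroˡ _)) (*ˢ-zeroˡ g (f≈0 ∘ suc) n)) (+-identityʳ _)

  constant-* : ∀ a g → (a q^ 0) *ˢ g ≈ˢ a • g
  constant-* a g zero    = +-identityʳ _
  constant-* a g (suc n) = trans (+-congˡ (*ˢ-zeroˡ g (λ _ → refl) n)) (+-identityʳ _)

  *ˢ-distribʳ : ∀ h f g → (f +ˢ g) *ˢ h ≈ˢ f *ˢ h +ˢ g *ˢ h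
  *ˢ-distribʳ h f g zero    = solve 3 (λ a b c → (a :+ b) :* c :+ con 0 := a :* c :+ con 0 :+ (b :* c :+ con 0)) refl _ _ _
  *ˢ-distribʳ h f g (suc n) = trans (+-congˡ (*ˢ-distribʳ h (f ∘ suc) (g ∘ suc) n))
    (solve 5 (λ a b c x y → (a :+ b) :* c :+ (x :+ y) := (a :* c :+ x) :+ (b :* c :+ y)) refl _ _ _ _ _)

  •-*ˢ : ∀ a f g → (a • f) *ˢ g ≈ˢ a • (f *ˢ g)
  •-*ˢ a f g zero    = solve 3 (λ a b c → a :* b :* c :+ con 0 := a :* (b :* c :+ con 0)) refl _ _ _
  •-*ˢ a f g (suc n) = trans (+-congˡ (•-*ˢ a (f ∘ suc) g n))
    (solve 4 (λ a b c d → a :* b :* c :+ a :* d := a :* (b :* c :+ d)) refl _ _ _ _)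

  -- The sum peeled from its other end, as commutativity requires.
  *ˢ-sucʳ : ∀ f g n → (f *ˢ g) (suc n) ≈ f (suc n) * g 0 + (f *ˢ (g ∘ suc)) n
  *ˢ-sucʳ f g zero    = solve 4 (λ a b c d → a :* b :+ (c :* d :+ con 0) := c :* d :+ (a :* b :+ con 0)) refl _ _ _ _
  *ˢ-sucʳ f g (suc n) = trans (+-congˡ (*ˢ-sucʳ (f ∘ suc) g n))
    (solve 5 (λ a b c d x → a :* b :+ (c :* d :+ x) := c :* d :+ (a :* b :+ x)) refl _ _ _ _ _)

  *ˢ-comm : ∀ f g → f *ˢ g ≈ˢ g *ˢ f
  *ˢ-comm f g zero    = +-congʳ (*-comm _ _)
  *ˢ-comm f g (suc n) = trans (+-cong (*-comm _ _) (*ˢ-comm (f ∘ suc) g n)) (sym (*ˢ-sucʳ g f n))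

  *ˢ-assoc : ∀ f g h → (f *ˢ g) *ˢ h ≈ˢ f *ˢ (g *ˢ h)
  *ˢ-assoc f g h zero    = solve 3 (λ a b c → (a :* b :+ con 0) :* c :+ con 0 := a :* (b :* c :+ con 0) :+ con 0) refl _ _ _
  *ˢ-assoc f g h (suc n) = begin
    (f 0 * g 0 + 0#) * h (suc n) + (((f *ˢ g) ∘ suc) *ˢ h) n
      ≈⟨ +-cong (*-congʳ (+-identityʳ _)) (*ˢ-distribʳ h (f 0 • (g ∘ suc)) ((f ∘ suc) *ˢ g) n) ⟩
    f 0 * g 0 * h (suc n) + (((f 0 • (g ∘ suc)) *ˢ h) n + (((f ∘ suc) *ˢ g) *ˢ h) n)
      ≈⟨ +-congˡ (+-cong (•-*ˢ (f 0) (g ∘ suc) h n) (*ˢ-assoc (f ∘ suc) g h n)) ⟩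
    f 0 * g 0 * h (suc n) + (f 0 * ((g ∘ suc) *ˢ h) n + ((f ∘ suc) *ˢ (g *ˢ h)) n)
      ≈⟨ solve 5 (λ a b c x y → a :* b :* c :+ (a :* x :+ y) := a :* (b :* c :+ x) :+ y) refl _ _ _ _ _ ⟩
    f 0 * (g 0 * h (suc n) + ((g ∘ suc) *ˢ h) n) + ((f ∘ suc) *ˢ (g *ˢ h)) n ∎

  *ˢ-identityˡ : ∀ f → 1ˢ *ˢ f ≈ˢ f
  *ˢ-identityˡ f n = trans (constant-* 1# f n) (*-identityˡ _)

  -ˢ_ : Series → Series
  (-ˢ f) n = - f n

  -- The quotient is formed by coarsening the equality on `Series`, so that the series themselves
  -- stay unchanged.
  truncated : ℕ → CommutativeRing c ℓ
  truncated n = record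
    { Carrier = Series ; _≈_ = _≈[ n ]_ ; _+_ = _+ˢ_ ; _*_ = _*ˢ_ ; -_ = -ˢ_ ; 0# = 0ˢ ; 1# = 1ˢ
    ; isCommutativeRing = record
      { isRing = record
        { +-isAbelianGroup = record
          { isGroup = record
            { isMonoid = record
              { isSemigroup = record
                { isMagma = record
                  { isEquivalence = record
                    { refl  = λ m _ → refl
                    ; sym   = λ p m m≤n → sym (p m m≤n)
                    ; trans = λ p q m m≤n → trans (p m m≤n) (q m m≤n)
                    }
                  ; ∙-cong = λ p q m m≤n → +-cong (p m m≤n) (q m m≤n)
                  }
                ; assoc = λ f g h m _ → +-assoc _ _ _
                }
              ; identity = (λ f m _ → +-identityˡ _) , (λ f m _ → +-identityʳ _)
              }
            ; inverse = (λ f m _ → -‿inverseˡ _) , (λ f m _ → -‿inverseʳ _)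
            ; ⁻¹-cong = λ p m m≤n → -‿cong (p m m≤n)
            }
          ; comm = λ f g m _ → +-comm _ _
          }
        ; *-cong     = *ˢ-cong n
        ; *-assoc    = λ f g h m _ → *ˢ-assoc f g h m
        ; *-identity = (λ f m _ → *ˢ-identityˡ f m) , (λ f m _ → trans (*ˢ-comm f 1ˢ m) (*ˢ-identityˡ f m))
        ; distrib    = (λ h f g m _ → trans (*ˢ-comm h (f +ˢ g) m) (trans (*ˢ-distribʳ h f g m) (+-cong (*ˢ-comm f h m) (*ˢ-comm g h m))))
                     , (λ h f g m _ → *ˢ-distribʳ h f g m)
        }
      ; *-comm = λ f g m _ → *ˢ-comm f g m
      }
    }

  monomial-cong : ∀ {a b} m → a ≈ b → a q^ m ≈ˢ b q^ m
  monomial-cong m a≈b n with n ≡ᵇ m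
  ... | true  = a≈b
  ... | false = refl

  monomial-* : ∀ a m b k → (a q^ m) *ˢ (b q^ k) ≈ˢ (a * b) q^ (m +ᴺ k)
  monomial-* a zero    b k n = trans (constant-* a (b q^ k) n) (scale (n ≡ᵇ k))
    where
    scale : ∀ c → a * (if c then b else 0#) ≈ (if c then a * b else 0#)
    scale true  = refl
    scale false = zeroʳ a
  monomial-* a (suc m) b k zero    = trans (+-identityʳ _) (zeroˡ _)
  monomial-* a (suc m) b k (suc n) = trans (+-cong (zeroˡ _) (monomial-* a m b k n)) (+-identityˡ _)

  monomial-neg : ∀ a m → -ˢ (a q^ m) ≈ˢ (- a) q^ m
  monomial-neg a m n with n ≡ᵇ m
  ... | true  = refl
  ... | false = -0#≈0#

  monomial-vanishes : ∀ a {m n} → n < m → a q^ m ≈[ n ] 0ˢ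
  monomial-vanishes a {m} n<m k k≤n = reflexive (≡.cong (if_then a else 0#) (≡ᵇ-false {k} {m} (λ { ≡.refl → <⇒≱ n<m k≤n })))

  module _ (n : ℕ) where

    private module T = CommutativeRing (truncated n)
    open Chains (truncated n) using (poch)
    open import Algebra.Properties.Semiring.Exp T.semiring using () renaming (_^_ to _^ᵀ_)

    ^ᵀ≡^ˢ : ∀ f k → f ^ᵀ k ≡ f ^ˢ k
    ^ᵀ≡^ˢ f zero    = ≡.refl
    ^ᵀ≡^ˢ f (suc k) = ≡.cong (f *ˢ_) (^ᵀ≡^ˢ f k)

    monomial-^ : ∀ a m k → (a q^ m) ^ᵀ k ≈ˢ (a ^ k) q^ (k *ᴺ m)
    monomial-^ a m zero    j = refl
    monomial-^ a m (suc k) j = trans (*ˢ-congˡ-≈ˢ (a q^ m) (monomial-^ a m k) j) (monomial-* a m (a ^ k) (k *ᴺ m) j)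

    poch≡pochhammer : ∀ a b N → poch a b N ≡ pochhammer a b N
    poch≡pochhammer a b zero    = ≡.refl
    poch≡pochhammer a b (suc N) = ≡.cong₂ (λ p w → p *ˢ (1ˢ -ˢ a *ˢ w)) (poch≡pochhammer a b N) (^ᵀ≡^ˢ b N)

    -- Factors after the first `n` are 1 modulo qⁿ⁺¹, so every length `N ≥ n` will do.
    ∞≈poch : ∀ {a b} → a 0 ≈ 0# → b 0 ≈ 0# → ∀ N → n ≤ N → ⟨ a ⨾ b ⟩∞ ≈[ n ] poch a b N
    ∞≈poch {a} {b} a₀ b₀ N n≤N m m≤n = begin
      ⟨ a ⨾ b ⟩∞ m                  ≈⟨ pochhammer-stable {a} {b} a₀ b₀ m (N ∸ m) ⟨
      pochhammer a b (N ∸ m +ᴺ m) m ≈⟨ reflexive (≡.cong (λ k → pochhammer a b k m) (m∸n+n≡m (≤-trans m≤n n≤N))) ⟩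
      pochhammer a b N m            ≈⟨ reflexive (≡.cong (λ p → p m) (poch≡pochhammer a b N)) ⟨
      poch a b N m                  ∎

  1^k≈1 : ∀ k → 1# ^ k ≈ 1#
  1^k≈1 zero    = refl
  1^k≈1 (suc k) = trans (*-identityˡ _) (1^k≈1 k)

  -- The coefficient of qⁿ in the generating function.

  module Coefficient (x : Carrier) (t₀ n : ℕ) where

    t : ℕ
    t = suc t₀

    Q v : Series
    -- A part k of the strict partition adds 2k to the size of its double.
    Q = 1# q^ 2
    -- This is x - 1, in a form from which - (v z) becomes (1 - x) z by a double negation.
    v = (- (1# - x)) q^ 0

    module T = CommutativeRing (truncated n)
    open Chains (truncated n) using (poch; poch-cong)
    open Sums (truncated n)
    open Bars v Q t (s≤s z≤n)
    open import Algebra.Properties.Semiring.Exp T.semiring using () renaming (_^_ to _^ᵀ_; ^-congˡ to ^ᵀ-congˡ)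

    Q^ : ∀ k → Q ^ᵀ k ≈ˢ 1# q^ (k *ᴺ 2)
    Q^ k j = trans (monomial-^ n 1# 2 k j) (monomial-cong (k *ᴺ 2) (1^k≈1 k) j)

    1+v≈x : 1ˢ +ˢ v ≈ˢ x q^ 0
    1+v≈x zero    = begin
      1# + - (1# - x)         ≈⟨ +-congˡ (-‿+-comm _ _) ⟨
      1# + (- 1# + - - x)     ≈⟨ +-assoc _ _ _ ⟨
      1# + - 1# + - - x       ≈⟨ +-cong (-‿inverseʳ 1#) (-‿involutive x) ⟩
      0# + x                  ≈⟨ +-identityˡ x ⟩
      x                       ∎
    1+v≈x (suc _) = +-identityʳ _

    ^ᵀ-cong-≈ˢ : ∀ {f g} k → f ≈ˢ g → f ^ᵀ k ≈ˢ g ^ᵀ k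
    ^ᵀ-cong-≈ˢ zero    p j = refl
    ^ᵀ-cong-≈ˢ (suc k) p   = *ˢ-cong-≈ˢ p (^ᵀ-cong-≈ˢ k p)

    term-monomial : ∀ λs → term λs ≈ˢ (x ^ n̂ t (doubled λs)) q^ sum (doubled λs)
    term-monomial λs j = begin
      ((1ˢ +ˢ v) ^ᵀ k *ˢ Q ^ᵀ sum λs) j
        ≈⟨ *ˢ-cong-≈ˢ (λ i → trans (^ᵀ-cong-≈ˢ k 1+v≈x i) (monomial-^ n x 0 k i)) (Q^ (sum λs)) j ⟩
      (((x ^ k) q^ (k *ᴺ 0)) *ˢ (1# q^ (sum λs *ᴺ 2))) j
        ≈⟨ monomial-* (x ^ k) (k *ᴺ 0) 1# (sum λs *ᴺ 2) j ⟩
      ((x ^ k * 1#) q^ (k *ᴺ 0 +ᴺ sum λs *ᴺ 2)) j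
        ≈⟨ monomial-cong (k *ᴺ 0 +ᴺ sum λs *ᴺ 2) (*-identityʳ (x ^ k)) j ⟩
      ((x ^ k) q^ (k *ᴺ 0 +ᴺ sum λs *ᴺ 2)) j
        ≡⟨ ≡.cong (λ e → ((x ^ k) q^ e) j) (≡.trans (≡.cong₂ _+ᴺ_ (ℕ.*-zeroʳ k) (ℕ.*-comm (sum λs) 2)) (≡.sym (doubled-sum λs))) ⟩
      ((x ^ k) q^ sum (doubled λs)) j ∎
      where k = n̂ t (doubled λs)

    -- Filtering by size keeps exactly the monomials with exponent `n`.
    F̂-total : F̂ t x n ≈ total term (strictUpTo n) n
    F̂-total = go (strictUpTo n)
      where
      weights : List (List ℕ) → Carrier
      weights μs = foldr _+_ 0# (map (λ μ → x ^ n̂ t μ) μs)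
      size? = λ μ → sum μ ≟ n
      go : ∀ L → weights (filter size? (map doubled L)) ≈ total term L n
      go []       = refl
      go (λs ∷ L) = cases (size? (doubled λs))
        where
        μ = doubled λs
        coefficient : ∀ {b} → (n ≡ᵇ sum μ) ≡ b → (if b then x ^ n̂ t μ else 0#) ≈ term λs n
        coefficient e = sym (trans (term-monomial λs n) (reflexive (≡.cong (if_then x ^ n̂ t μ else 0#) e)))
        cases : Dec (sum μ ≡ n) → weights (filter size? (map doubled (λs ∷ L))) ≈ total term (λs ∷ L) n
        cases (yes e) = trans (reflexive (≡.cong weights (filter-accept size? {μ} {map doubled L} e))) (+-cong (coefficient (≡ᵇ-true {n} {sum μ} (≡.sym e))) (go L))
        cases (no ≢n) = trans (reflexive (≡.cong weights (filter-reject size? {μ} {map doubled L} ≢n)))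
          (trans (sym (+-identityˡ _)) (+-cong (coefficient (≡ᵇ-false {n} {sum μ} (≢n ∘ ≡.sym))) (go L)))

    -- A part above `n` forces the size above `n`. So the bound on the parts can grow to `M`, where
    -- all residue classes are complete.
    total-extend : ∀ k → total term (strictUpTo (k +ᴺ n)) n ≈ total term (strictUpTo n) n
    total-extend zero    = refl
    total-extend (suc k) = begin
      total term (strictUpTo m ++ map (suc m ∷_) (strictUpTo m)) n
        ≈⟨ total-++ term (strictUpTo m) _ n ≤-refl ⟩
      total term (strictUpTo m) n + total term (map (suc m ∷_) (strictUpTo m)) n
        ≈⟨ +-cong (total-extend k) (large (strictUpTo m)) ⟩
      total term (strictUpTo n) n + 0#
        ≈⟨ +-identityʳ _ ⟩
      total term (strictUpTo n) n ∎
      where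
      m = k +ᴺ n
      large : ∀ L → total term (map (suc m ∷_) L) n ≈ 0#
      large []       = refl
      large (λs ∷ L) = trans (+-cong
        (trans (term-monomial (suc m ∷ λs) n) (monomial-vanishes _ big n ≤-refl))
        (large L)) (+-identityʳ _)
        where
        big : n < sum (doubled (suc m ∷ λs))
        big = ≤-trans (s≤s (m≤n+m n k)) (≤-trans (m≤m+n (suc m) _) (≤-trans (m≤m+n (sum (suc m ∷ λs)) _) (≤-reflexive (≡.sym (doubled-sum (suc m ∷ λs))))))

    M : ℕ
    M = suc n *ᴺ t

    n≤M : n ≤ M
    n≤M = ≤-trans (n≤1+n n) (m≤m*n (suc n) t)

    F̂-total-M : F̂ t x n ≈ total term (strictUpTo M) n
    F̂-total-M = trans F̂-total (trans (sym (total-extend (M ∸ n))) (reflexive (≡.cong (λ m → total term (strictUpTo m) n) (m∸n+n≡m n≤M))))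

    Qᴺ≈0 : Q ^ᵀ suc n ≈[ n ] 0ˢ
    Qᴺ≈0 m m≤n = trans (Q^ (suc n) m) (monomial-vanishes 1# (m≤m*n (suc n) 2) m m≤n)

    open Factors n Qᴺ≈0

    z≈ : z ≈ˢ 1# q^ (2 *ᴺ t)
    z≈ j = trans (Q^ t j) (reflexive (≡.cong (λ e → (1# q^ e) j) (ℕ.*-comm t 2)))

    zz≈ : z *ˢ z ≈ˢ 1# q^ (4 *ᴺ t)
    zz≈ j = trans (*ˢ-cong-≈ˢ z≈ z≈ j) (trans (monomial-* 1# (2 *ᴺ t) 1# (2 *ᴺ t) j) (trans
      (monomial-cong (2 *ᴺ t +ᴺ 2 *ᴺ t) (*-identityˡ 1#) j) (reflexive (≡.cong (λ e → (1# q^ e) j) (four t)))))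
      where
      four : ∀ t → 2 *ᴺ t +ᴺ 2 *ᴺ t ≡ 4 *ᴺ t
      four = solve-∀

    -vz≈ : -ˢ (v *ˢ z) ≈ˢ (1# - x) q^ (2 *ᴺ t)
    -vz≈ j = trans (-‿cong (trans (*ˢ-congˡ-≈ˢ v z≈ j) (monomial-* (- (1# - x)) 0 1# (2 *ᴺ t) j)))
      (trans (monomial-neg _ (2 *ᴺ t) j) (monomial-cong (2 *ᴺ t) (trans (-‿cong (*-identityʳ _)) (-‿involutive _)) j))

    DD-product multiples pairs : Series
    DD-product = ⟨ (- 1#) q^ 2 ⨾ 1# q^ 2 ⟩∞
    multiples = ⟨ (1# - x) q^ (2 *ᴺ t) ⨾ 1# q^ (4 *ᴺ t) ⟩∞
    pairs = ⟨ (1# - x) q^ (2 *ᴺ t) ⨾ 1# q^ (2 *ᴺ t) ⟩∞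

    at-n : ∀ {f g} → f ≈ˢ g → f ≈[ n ] g
    at-n p m _ = p m

    DD-product≈ : product onePlus (down M) ≈[ n ] DD-product
    DD-product≈ = T.trans (product-onePlus M) (T.trans (poch-cong M (at-n (monomial-neg 1# 2)) T.refl)
      (T.sym (∞≈poch n refl refl M n≤M)))

    multiples≈ : poch (-ˢ (v *ˢ z)) (z *ˢ z) (suc n) ≈[ n ] multiples
    multiples≈ = T.trans (poch-cong (suc n) (at-n -vz≈) (at-n zz≈)) (T.sym (∞≈poch n refl refl (suc n) (n≤1+n n)))

    pairs≈ : ∀ k → poch (-ˢ (v *ˢ z)) z (suc n) ^ᵀ k ≈[ n ] pairs ^ˢ k
    pairs≈ k = T.trans
      (^ᵀ-congˡ k (T.trans (poch-cong (suc n) (at-n -vz≈) (at-n z≈)) (T.sym (∞≈poch n refl refl (suc n) (n≤1+n n)))))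
      (T.reflexive (^ᵀ≡^ˢ n pairs k))

    F̂-odd : ∀ k → t ≡ suc (k *ᴺ 2 +ᴺ 0) → F̂ t x n ≈ (DD-product *ˢ pairs ^ˢ k *ˢ multiples) n
    F̂-odd k t≡ = trans F̂-total-M (T.trans (total-odd k t≡)
      (T.trans (T.*-cong (T.*-cong multiples≈ (pairs≈ k)) DD-product≈)
      (T.trans (T.*-comm _ DD-product)
      (T.trans (T.*-congˡ {DD-product} (T.*-comm multiples (pairs ^ˢ k))) (T.sym (T.*-assoc DD-product (pairs ^ˢ k) multiples))))) n ≤-refl)

    module _ (k : ℕ) (t≡ : t ≡ suc (k *ᴺ 2 +ᴺ 1)) (½ √1-x : Carrier) (½*2≈1 : ½ * (1# + 1#) ≈ 1#) (√²≈ : √1-x * √1-x ≈ 1# - x) where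

      private
        s ½ˢ w : Series
        s  = √1-x q^ 0
        ½ˢ = ½ q^ 0
        w  = Q ^ᵀ suc k

        w≈ : w ≈ˢ 1# q^ t
        w≈ j = trans (Q^ (suc k) j) (reflexive (≡.cong (λ e → (1# q^ e) j) (≡.trans (≡.cong suc (ℕ.+-comm 1 (k *ᴺ 2))) (≡.sym t≡))))

        ½ˢ*2≈1 : ½ˢ *ˢ (1ˢ +ˢ 1ˢ) ≈ˢ 1ˢ
        ½ˢ*2≈1 zero    = trans (constant-* ½ (1ˢ +ˢ 1ˢ) 0) ½*2≈1
        ½ˢ*2≈1 (suc j) = trans (constant-* ½ (1ˢ +ˢ 1ˢ) (suc j)) (trans (*-congˡ (+-identityʳ 0#)) (zeroʳ ½))

        v≈ : v ≈ˢ -ˢ (s *ˢ s)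
        v≈ j = sym (trans (-‿cong (trans (monomial-* √1-x 0 √1-x 0 j) (monomial-cong 0 √²≈ j))) (monomial-neg (1# - x) 0 j))

        -w≈ : -ˢ w ≈ˢ (- 1#) q^ t
        -w≈ j = trans (-‿cong (w≈ j)) (monomial-neg 1# t j)

        -[aq^0*w]≈ : ∀ a → -ˢ ((a q^ 0) *ˢ w) ≈ˢ (- a) q^ t
        -[aq^0*w]≈ a j = trans (-‿cong (trans (*ˢ-congˡ-≈ˢ (a q^ 0) w≈ j) (monomial-* a 0 1# t j)))
          (trans (monomial-neg (a * 1#) t j) (monomial-cong t (-‿cong (*-identityʳ a)) j))

        θ : Carrier → Series
        θ a = ⟨ a q^ t ⨾ (- 1#) q^ t ⟩∞

        θ≈ : ∀ {a f} → f ≈ˢ a q^ t → poch f (-ˢ w) (suc n) ≈[ n ] θ a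
        θ≈ p = T.trans (poch-cong (suc n) (at-n p) (at-n -w≈)) (T.sym (∞≈poch n refl refl (suc n) (n≤1+n n)))

        H : Series
        H = ½ • (θ (- √1-x) +ˢ θ √1-x)

        half≈ : ½ˢ *ˢ (poch (-ˢ (s *ˢ w)) (-ˢ w) (suc n) +ˢ poch (-ˢ ((-ˢ s) *ˢ w)) (-ˢ w) (suc n)) ≈[ n ] H
        half≈ = T.trans (T.*-congˡ {½ˢ} (T.+-cong (θ≈ (-[aq^0*w]≈ √1-x)) (θ≈ minus))) (at-n (constant-* ½ _))
          where
          minus : -ˢ ((-ˢ s) *ˢ w) ≈ˢ √1-x q^ t
          minus j = trans (-‿cong (*ˢ-cong-≈ˢ {g = w} (monomial-neg √1-x 0) (λ _ → refl) j))
            (trans (-[aq^0*w]≈ (- √1-x) j) (monomial-cong t (-‿involutive _) j))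

      F̂-even : F̂ t x n ≈ (DD-product *ˢ pairs ^ˢ k *ˢ multiples *ˢ (½ • (⟨ (- √1-x) q^ t ⨾ (- 1#) q^ t ⟩∞ +ˢ ⟨ √1-x q^ t ⨾ (- 1#) q^ t ⟩∞))) n
      F̂-even = trans F̂-total-M (T.trans (total-even k t≡ ½ˢ s (at-n ½ˢ*2≈1) (at-n v≈))
        (T.trans (T.*-cong (T.*-cong multiples≈ (T.*-cong half≈ (pairs≈ k))) DD-product≈)
          (rearrange multiples H (pairs ^ˢ k) DD-product)) n ≤-refl)
        where
        open import Algebra.Solver.Ring.NaturalCoefficients.Default T.commutativeSemiring using () renaming (solve to solveᵀ; _:=_ to _:=ᵀ_; _:*_ to _:*ᵀ_)
        rearrange : ∀ a h p d → a *ˢ (h *ˢ p) *ˢ d T.≈ d *ˢ p *ˢ a *ˢ h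
        rearrange = solveᵀ 4 (λ a h p d → a :*ᵀ (h :*ᵀ p) :*ᵀ d :=ᵀ d :*ᵀ p :*ᵀ a :*ᵀ h) T.refl

-- The two parities of `t`.

odd⇒ : ∀ {t} → 2 ∤ t → ∃[ k ] t ≡ suc (k *ᴺ 2 +ᴺ 0)
odd⇒ {t} 2∤t = t / 2 , ≡.trans (m≡m%n+[m/n]*n t 2) (≡.trans (≡.cong (_+ᴺ t / 2 *ᴺ 2) (rem (t % 2) ≡.refl (m%n<n t 2))) (≡.cong suc (≡.sym (ℕ.+-identityʳ _))))
  where
  rem : ∀ r → t % 2 ≡ r → r < 2 → t % 2 ≡ 1
  rem zero          e _ = contradiction (m%n≡0⇒n∣m t 2 e) 2∤t
  rem (suc zero)    e _ = e
  rem (suc (suc r)) e (s≤s (s≤s ()))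

even⇒ : ∀ {t} → 0 < t → 2 ∣ t → ∃[ k ] t ≡ suc (k *ᴺ 2 +ᴺ 1)
-- The quotient `suc k` is the middle residue t/2, which leaves `k` pairs.
even⇒ 0<t (divides (suc k) e) = k , ≡.trans e (≡.cong suc (ℕ.+-comm 1 (k *ᴺ 2)))
even⇒ () (divides zero ≡.refl)

theorem1p2 : ∀ {c ℓ} (R : CommutativeRing c ℓ) → let open CommutativeRing R in let open PowerSeries R in
    (x : Carrier) (t : ℕ) → .{{_ : NonZero t}} →
    (2 ∤ t →
    F̂ t x ≈ˢ
    ⟨ (- 1#) q^ 2 ⨾ 1# q^ 2 ⟩∞
    *ˢ ⟨ (1# - x) q^ (2 *ᴺ t) ⨾ 1# q^ (2 *ᴺ t) ⟩∞ ^ˢ ((t ∸ 1) / 2)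
    *ˢ ⟨ (1# - x) q^ (2 *ᴺ t) ⨾ 1# q^ (4 *ᴺ t) ⟩∞)
    ×
    (2 ∣ t → (½ √1-x : Carrier) → ½ * (1# + 1#) ≈ 1# → √1-x * √1-x ≈ 1# - x →
    F̂ t x ≈ˢ
    ⟨ (- 1#) q^ 2 ⨾ 1# q^ 2 ⟩∞
    *ˢ ⟨ (1# - x) q^ (2 *ᴺ t) ⨾ 1# q^ (2 *ᴺ t) ⟩∞ ^ˢ ((t ∸ 2) / 2)
    *ˢ ⟨ (1# - x) q^ (2 *ᴺ t) ⨾ 1# q^ (4 *ᴺ t) ⟩∞
    *ˢ (½ • (⟨ (- √1-x) q^ t ⨾ (- 1#) q^ t ⟩∞ +ˢ ⟨ √1-x q^ t ⨾ (- 1#) q^ t ⟩∞)))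
theorem1p2 R x t = odd , even (>-nonZero⁻¹ t)
  where
  open CommutativeRing R
  open PowerSeries R
  open TruncatedSeries R

  odd : 2 ∤ t → F̂ t x ≈ˢ
    ⟨ (- 1#) q^ 2 ⨾ 1# q^ 2 ⟩∞
    *ˢ ⟨ (1# - x) q^ (2 *ᴺ t) ⨾ 1# q^ (2 *ᴺ t) ⟩∞ ^ˢ ((t ∸ 1) / 2)
    *ˢ ⟨ (1# - x) q^ (2 *ᴺ t) ⨾ 1# q^ (4 *ᴺ t) ⟩∞
  odd 2∤t n with odd⇒ 2∤t
  -- What remains is to identify the exponent `(t ∸ 1) / 2` with `k`.
  ... | k , ≡.refl = ≡.subst (λ e → F̂ t x n ≈
          (⟨ (- 1#) q^ 2 ⨾ 1# q^ 2 ⟩∞ *ˢ ⟨ (1# - x) q^ (2 *ᴺ t) ⨾ 1# q^ (2 *ᴺ t) ⟩∞ ^ˢ e *ˢ ⟨ (1# - x) q^ (2 *ᴺ t) ⨾ 1# q^ (4 *ᴺ t) ⟩∞) n)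
        (≡.sym (≡.trans (≡.cong (_/ 2) (ℕ.+-identityʳ (k *ᴺ 2))) (m*n/n≡m k 2)))
        (Coefficient.F̂-odd x (k *ᴺ 2 +ᴺ 0) n k ≡.refl)

  even : 0 < t → 2 ∣ t → (½ √1-x : Carrier) → ½ * (1# + 1#) ≈ 1# → √1-x * √1-x ≈ 1# - x → F̂ t x ≈ˢ
    ⟨ (- 1#) q^ 2 ⨾ 1# q^ 2 ⟩∞
    *ˢ ⟨ (1# - x) q^ (2 *ᴺ t) ⨾ 1# q^ (2 *ᴺ t) ⟩∞ ^ˢ ((t ∸ 2) / 2)
    *ˢ ⟨ (1# - x) q^ (2 *ᴺ t) ⨾ 1# q^ (4 *ᴺ t) ⟩∞
    *ˢ (½ • (⟨ (- √1-x) q^ t ⨾ (- 1#) q^ t ⟩∞ +ˢ ⟨ √1-x q^ t ⨾ (- 1#) q^ t ⟩∞))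
  even 0<t 2∣t ½ √1-x ½*2≈1 √²≈ n with even⇒ 0<t 2∣t
  ... | k , ≡.refl = ≡.subst (λ e → F̂ t x n ≈
          (⟨ (- 1#) q^ 2 ⨾ 1# q^ 2 ⟩∞ *ˢ ⟨ (1# - x) q^ (2 *ᴺ t) ⨾ 1# q^ (2 *ᴺ t) ⟩∞ ^ˢ e *ˢ ⟨ (1# - x) q^ (2 *ᴺ t) ⨾ 1# q^ (4 *ᴺ t) ⟩∞
           *ˢ (½ • (⟨ (- √1-x) q^ t ⨾ (- 1#) q^ t ⟩∞ +ˢ ⟨ √1-x q^ t ⨾ (- 1#) q^ t ⟩∞))) n)
        (≡.sym (≡.trans (≡.cong (_/ 2) (ℕ.m+n∸n≡m (k *ᴺ 2) 1)) (m*n/n≡m k 2)))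
        (Coefficient.F̂-even x (k *ᴺ 2 +ᴺ 1) n k ≡.refl ½ √1-x ½*2≈1 √²≈)
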